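{- For every $\varphi\in\mathcal{L}$: there exists a closed tableau in the calculus $\mathbf{Tab}_{\mathbf{LGDDA}}$ starting from $\{\varphi\}$ if and only if $\varphi$ is not satisfiable in $\mathbf{LGDDA}$.
   Context: Fix a countably infinite set of atoms $\mathit{Atm}$ and a finite set of agents $\mathit{Agt}=\{1,\dots,n\}$; a group is a non-empty subset $J\subseteq\mathit{Agt}$. $\mathbb{N}_0$ (resp. $\mathbb{N}_1$) are the naturals with (resp. without) $0$; $\mathbb{N}_0^{\omega}=\mathbb{N}_0\cup\{\omega\}$, $\mathbb{N}_1^{\omega}=\mathbb{N}_1\cup\{\omega\}$ with $\omega$ infinite. A multiset over $X$ is a function $X\to\mathbb{N}_0^{\omega}$. A possibly infinite sum of grades equals the sum of its non-zero summands if there are finitely many and none is $\omega$, and $\omega$ otherwise. $\max^*X=\max(X\cup\{\omega\})$... as printed in the paper, but in the rule below it is used as the maximum grade present, with value $0$ if none; we write $\max^0 Z$ for $\max(Z\cup\{0\})$. For $k\in\mathbb{N}_0$ and group $J$, $P(J,k)$ is the set of $\delta:J\to\mathbb{N}_0$ with $\sum_{i\in J}\delta(i)=k$. $\mathcal{L}_0$: $\alpha::=p\mid\neg\alpha\mid\alpha\wedge\alpha\mid\triangle_i^k\alpha$ ($p\in\mathit{Atm}$, $i\in\mathit{Agt}$, $k\in\mathbb{N}_1^{\omega}$). $\mathcal{L}$: $\varphi::=\alpha\mid\neg\varphi\mid\varphi\wedge\varphi\mid\Box_J^k\varphi$ ($\alpha\in\mathcal{L}_0$, $J$ a group, $k\in\mathbb{N}_0$).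 Semantics (MAGBM): a state is $S=(\mathcal{B}_1,\dots,\mathcal{B}_n,V)$ with each $\mathcal{B}_i$ a multiset over $\mathcal{L}_0$ and $V\subseteq\mathit{Atm}$; $\mathbf{S}$ the set of states. $S\models p$ iff $p\in V$; Boolean clauses as usual; $S\models\triangle_i^k\alpha$ iff $\mathcal{B}_i(\alpha)\ge k$. $\mathcal{B}_J(\alpha)=\sum_{i\in J}\mathcal{B}_i(\alpha)$; $S\mathcal{R}_J^kS'$ iff $\sum_{\alpha\in\mathcal{L}_0,S'\not\models\alpha}\mathcal{B}_J(\alpha)\le k$. An MAGBM is $(S,U)$ with $S\in\mathbf{S}$, $U\subseteq\mathbf{S}$; $(S,U)\models\alpha$ iff $S\models\alpha$ ($\alpha\in\mathcal{L}_0$); Boolean clauses as usual; $(S,U)\models\Box_J^k\varphi$ iff for all $S'\in U$ with $S\mathcal{R}_J^kS'$, $(S',U)\models\varphi$. $\varphi$ is satisfiable in $\mathbf{LGDDA}$ iff some MAGBM satisfies it. Tableau calculus $\mathbf{Tab}_{\mathbf{LGDDA}}$: rules transform a finite set of formulas (numerator) into one or more sets (denominators); a tableau is a tree built by applying rules starting from a set, and it is closed if every branch ends in a set containing $\bot$. Rules: the standard classical rules ($\{\neg\neg\varphi\}\cup X / \{\varphi\}\cup X$; $\{\varphi\wedge\psi\}\cup X/\{\varphi,\psi\}\cup X$; $\{\neg(\varphi\wedge\psi)\}\cup X/\{\neg\varphi\}\cup X\mid\{\neg\psi\}\cup X$; $\{\varphi,\neg\varphi\}\cup X/\{\bot\}$),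 plus: ($\triangle$-Mon) $\{\triangle_i^k\alpha,\neg\triangle_i^{k+t}\alpha\}\cup X/\{\bot\}$; ($\Box$-Elim) $\{\neg\Box_J^k\varphi\}\cup X$ / one denominator $\{\neg\varphi\}\cup\{\psi:\Box_{J'}^{k'}\psi\in Y\}\cup\{\alpha:\triangle_i^{k'}\alpha\in Y,\ i\in J\}$ for each $Y\subseteq X$ such that there exists $\delta\in P(J,k)$ with: for every $\Box_{J'}^{k'}\psi\in Y$, $J'\subseteq J$ and $\sum_{i\in J'}\delta(i)\le k'$; and for every $i\in J$, $\sum_{\alpha\in\mathcal{L}_0}\max^0\{k':\triangle_i^{k'}\alpha\in X\setminus Y\}\le\delta(i)$.
   Formalization: Two misprinted rules are corrected: △-Mon closes {△_i^{k+t}α, ¬△_i^k α} (t may be ω), as △_i^1 p ∧ ¬△_i^2 p is satisfiable; in □-Elim the boxes in Y are exactly those of X with J'⊆J and sum ≤ k', else Y=∅ leaves the unsatisfiable ¬□_J^0 p ∧ □_J^0(p∧p) open. -}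

module Defs where

open import Data.Bool.Base using (Bool; T; if_then_else_)
open import Data.Fin.Base using (Fin)
open import Data.Fin.Subset using (Subset; Nonempty) renaming (_∈_ to _∈ₛ_; _⊆_ to _⊆ₛ_)
open import Data.Fin.Subset.Properties using () renaming (_∈?_ to _∈ₛ?_)
open import Data.List.Base using (List; []; _∷_; map; filter; foldr; mapMaybe; allFin)
open import Data.List.Membership.Propositional using (_∈_; _∉_)
open import Data.List.Relation.Binary.BagAndSetEquality using (_∼[_]_; set)
open import Data.List.Relation.Binary.Subset.Propositional using (_⊆_)
open import Data.List.Relation.Unary.All using (All; []; _∷_)
open import Data.List.Relation.Unary.Any using (Any)
open import Data.List.Relation.Unary.Unique.Propositional using (Unique)
open import Data.Maybe.Base using (Maybe; just; nothing)
open import Data.Nat.Base using (ℕ; _+_; _≤_)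
open import Data.Nat.ListAction using (sum)
open import Data.Product.Base using (Σ; ∃; ∃-syntax; _×_; _,_)
open import Data.Refinement.Base using (Refinement-syntax; value)
open import Data.Sum.Base using (_⊎_)
open import Data.Unit.Base using (⊤)
open import Function.Bundles using (_↔_; _⇔_; Inverse)
open import Level using (0ℓ)
open import Relation.Binary.Construct.Add.Supremum.NonStrict _≤_ using (_≤⁺_)
open import Relation.Binary.PropositionalEquality using (_≡_; _≢_; refl; cong; cong₂)
open import Relation.Nullary using (¬_; does)
open import Relation.Nullary.Construct.Add.Supremum using (_⁺)
  renaming ([_] to fin; ⊤⁺ to ω)
open import Relation.Unary using (Pred)

------------------------------------------------------------------------
-- Grades

ℕω : Set
ℕω = ℕ ⁺

infixl 6 _+ω_

_+ω_ : ℕω → ℕω → ℕω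
fin k +ω fin l = fin (k + l)
fin _ +ω ω     = ω
ω     +ω _     = ω

sumω : List ℕω → ℕω
sumω = foldr _+ω_ (fin 0)

ℕ₁ω : Set
ℕ₁ω = [ k ∈ ℕω ∣ k ≢ fin 0 ]

Enumerates : {A : Set} → List A → Pred A 0ℓ → Set
Enumerates xs P = Unique xs × (∀ x → x ∈ xs ⇔ P x)

-- FiniteSupport P f xs: the non-zero summands of ∑_{x ∈ P} f x are finitely
-- many, none of them is ω, and xs lists their indices.
FiniteSupport : {A : Set} → Pred A 0ℓ → (A → ℕω) → List A → Set
FiniteSupport P f xs =
  Enumerates xs (λ x → P x × f x ≢ fin 0) × All (λ x → f x ≢ ω) xs

-- Sum P f s: the possibly infinite sum ∑_{x ∈ P} f x equals s.  It is a
-- relation because finiteness of the support is not decidable.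
data Sum {A : Set} (P : Pred A 0ℓ) (f : A → ℕω) : ℕω → Set where
  finite   : ∀ xs → FiniteSupport P f xs → Sum P f (sumω (map f xs))
  infinite : ¬ (∃[ xs ] FiniteSupport P f xs) → Sum P f ω

-- Max⁰ Z m: m = max (Z ∪ {0}).
Max⁰ : Pred ℕω 0ℓ → ℕω → Set
Max⁰ Z m = (m ≡ fin 0 ⊎ Z m) × (∀ k → Z k → k ≤⁺ m)

------------------------------------------------------------------------

module LGDDA (Atm : Set) (Atm↔ℕ : Atm ↔ ℕ) (n : ℕ) where

  Agt : Set
  Agt = Fin n

  Group : Set
  Group = [ J ∈ Subset n ∣ Nonempty J ]

  members : Group → List Agt
  members J = filter (_∈ₛ? value J) (allFin n)

  ----------------------------------------------------------------------
  -- Formulas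

  -- The grammars of ℒ₀ and ℒ share their Boolean part.  Indexing one datatype
  -- by the language, rather than adding a constructor ℒ₀ → ℒ, ensures that each
  -- Boolean combination of ℒ₀-formulas occurs only once in ℒ.
  data Language : Set where
    explicit full : Language

  infixr 6 _∧'_
  infix  7 ¬'_

  data Formula : Language → Set where
    atom : ∀ {l} → Atm → Formula l
    ¬'_  : ∀ {l} → Formula l → Formula l
    _∧'_ : ∀ {l} → Formula l → Formula l → Formula l
    △    : ∀ {l} → Agt → ℕ₁ω → Formula explicit → Formula l
    □    : Group → ℕ → Formula full → Formula full

  ℒ₀ ℒ : Set
  ℒ₀ = Formula explicit
  ℒ  = Formula full

  -- The inclusion of ℒ₀ in ℒ.
  ↑ : ℒ₀ → ℒ
  ↑ (atom p)  = atom p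
  ↑ (¬' α)    = ¬' ↑ α
  ↑ (α ∧' β)  = ↑ α ∧' ↑ β
  ↑ (△ i k α) = △ i k α

  -- ⊥ is not primitive: it abbreviates p ∧ ¬p for a fixed atom p.
  ⊥' : ℒ
  ⊥' = atom p ∧' ¬' atom p
    where p = Inverse.from Atm↔ℕ 0

  ----------------------------------------------------------------------
  -- Semantics

  -- Valuations are given by characteristic functions.  For an arbitrary
  -- predicate V, the truth of p would not be ¬¬-stable, and then the step from
  -- □ ¬¬p to □ p would not be constructively sound.
  record State : Set where
    field
      base : Agt → ℒ₀ → ℕω
      val  : Atm → Bool

  open State public

  infix 4 _⊨₀_ _,_⊨_

  _⊨₀_ : State → ℒ₀ → Set
  S ⊨₀ atom p  = T (val S p)
  S ⊨₀ ¬' α    = ¬ (S ⊨₀ α)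
  S ⊨₀ α ∧' β  = S ⊨₀ α × S ⊨₀ β
  S ⊨₀ △ i k α = value k ≤⁺ base S i α

  groupBase : State → Group → ℒ₀ → ℕω
  groupBase S J α = sumω (map (λ i → base S i α) (members J))

  R : Group → ℕ → State → State → Set
  R J k S S' =
    ∃[ s ] Sum (λ α → ¬ (S' ⊨₀ α)) (groupBase S J) s × s ≤⁺ fin k

  _,_⊨_ : State → Pred State 0ℓ → ℒ → Set
  S , U ⊨ atom p  = S ⊨₀ atom p
  S , U ⊨ ¬' φ    = ¬ (S , U ⊨ φ)
  S , U ⊨ φ ∧' ψ  = (S , U ⊨ φ) × (S , U ⊨ ψ)
  S , U ⊨ △ i k α = S ⊨₀ △ i k α
  S , U ⊨ □ J k φ = ∀ S' → U S' → R J k S S' → S' , U ⊨ φ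

  -- On ℒ₀ the two satisfaction relations coincide.
  ⊨-↑ : ∀ S U α → (S , U ⊨ ↑ α) ≡ (S ⊨₀ α)
  ⊨-↑ S U (atom p)  = refl
  ⊨-↑ S U (¬' α)    = cong ¬_ (⊨-↑ S U α)
  ⊨-↑ S U (α ∧' β)  = cong₂ _×_ (⊨-↑ S U α) (⊨-↑ S U β)
  ⊨-↑ S U (△ i k α) = refl

  Satisfiable : ℒ → Set₁
  Satisfiable φ = ∃[ S ] Σ (Pred State 0ℓ) λ U → S , U ⊨ φ

  ----------------------------------------------------------------------
  -- Tableaux

  -- Finite sets of formulas are lists, considered up to ∼[ set ].
  FinSet : Set
  FinSet = List ℒ

  -- An element of P(J,k); the values of δ outside J play no role.
  sumOver : Group → (Agt → ℕ) → ℕ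
  sumOver J δ = sum (map δ (members J))

  Distribution : Group → ℕ → (Agt → ℕ) → Set
  Distribution J k δ = sumOver J δ ≡ k

  -- The set {k' : △ᵢ^k' α ∈ X ∖ Y}.
  DroppedGrade : FinSet → FinSet → Agt → ℒ₀ → Pred ℕω 0ℓ
  DroppedGrade X Y i α g =
    ∃[ k ] value k ≡ g × △ i k α ∈ X × △ i k α ∉ Y

  -- The boxes of Y are exactly the boxes of X that apply at distance δ.  The
  -- inclusion from right to left is needed for completeness: with the other
  -- inclusion alone Y = ∅ would always be admissible (for X without △), so that
  -- {¬□_J^k p, □_J^k (p ∧ q)} would have the open denominator {¬p}.
  Admissible : Group → ℕ → FinSet → FinSet → Set
  Admissible J k X Y =
    ∃[ δ ] Distribution J k δ
         × (∀ J' k' ψ → □ J' k' ψ ∈ X →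
              □ J' k' ψ ∈ Y ⇔ (value J' ⊆ₛ value J × sumOver J' δ ≤ k'))
         × (∀ i → i ∈ₛ value J →
              Σ (ℒ₀ → ℕω) λ f → (∀ α → Max⁰ (DroppedGrade X Y i α) (f α))
                × (∃[ s ] Sum (λ _ → ⊤) f s × s ≤⁺ fin (δ i)))

  unbox : Group → ℒ → Maybe ℒ
  unbox J (□ _ _ ψ) = just ψ
  unbox J (△ i _ α) = if does (i ∈ₛ? value J) then just (↑ α) else nothing
  unbox J _         = nothing

  denominator : Group → ℒ → FinSet → FinSet
  denominator J φ Y = ¬' φ ∷ mapMaybe (unbox J) Y

  infix 4 _⟶_

  -- Γ ⟶ Ds: some rule has an instance with numerator Γ and denominators Ds.
  data _⟶_ (Γ : FinSet) : List FinSet → Set where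
    ¬¬-rule : ∀ {φ X} → Γ ∼[ set ] (¬' ¬' φ ∷ X) →
              Γ ⟶ (φ ∷ X) ∷ []

    ∧-rule  : ∀ {φ ψ X} → Γ ∼[ set ] (φ ∧' ψ ∷ X) →
              Γ ⟶ (φ ∷ ψ ∷ X) ∷ []

    ¬∧-rule : ∀ {φ ψ X} → Γ ∼[ set ] (¬' (φ ∧' ψ) ∷ X) →
              Γ ⟶ (¬' φ ∷ X) ∷ (¬' ψ ∷ X) ∷ []

    ⊥-rule  : ∀ {φ X} → Γ ∼[ set ] (φ ∷ ¬' φ ∷ X) →
              Γ ⟶ (⊥' ∷ []) ∷ []

    -- The larger grade is on the positive formula: since △ᵢ^k α means
    -- "grade at least k", {△ᵢ^k α, ¬△ᵢ^(k+t) α} is satisfiable when k < k+t.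
    △-mon   : ∀ {i α X} k k⁺ t → value k⁺ ≡ value k +ω t →
              Γ ∼[ set ] (△ i k⁺ α ∷ ¬' △ i k α ∷ X) →
              Γ ⟶ (⊥' ∷ []) ∷ []

    □-elim  : ∀ {J k φ X} Ds → Γ ∼[ set ] (¬' □ J k φ ∷ X) →
              (∀ D → Any (D ∼[ set ]_) Ds ⇔
                (∃[ Y ] Y ⊆ X × Admissible J k X Y × D ∼[ set ] denominator J φ Y)) →
              Γ ⟶ Ds

  data Tableau : FinSet → Set where
    leaf : ∀ Γ → Tableau Γ
    node : ∀ {Γ Ds} → Γ ⟶ Ds → All Tableau Ds → Tableau Γ

  Closed    : ∀ {Γ} → Tableau Γ → Set
  AllClosed : ∀ {Ds} → All Tableau Ds → Set

  Closed (leaf Γ)    = ⊥' ∈ Γ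
  Closed (node _ ts) = AllClosed ts

  AllClosed []       = ⊤
  AllClosed (t ∷ ts) = Closed t × AllClosed ts

{-# OPTIONS --safe #-}

-- Soundness: if S 𝓡_J^k S′ then the grades which each i ∈ J gives to the formulas
-- false at S′ sum to at most k, hence are dominated by some δ ∈ P(J,k), and this δ
-- makes one of the denominators of □-elim true at S′.
--
-- Completeness: apply the Boolean rules as long as possible, then □-elim to every
-- ¬□; this terminates because the total size decreases.  If no closed tableau is
-- found, a finite tree of saturated sets remains.  The states of its model are the
-- nodes of the tree, named by natural numbers, and each name c owns a fresh atom
-- which is true at the state c only.  The grade of the negation of that atom is the
-- distance of the state c which is not yet explained by the △-formulas: it makes the
-- distance of a successor exactly the δ of the □-elim step which created it, and
-- that of every other state infinite.

module Submission where

open import Defs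
open import Data.Bool.Base using (true; false; if_then_else_)
open import Data.Bool.Properties using (T?) renaming (_≟_ to _≟ᵇ_)
open import Data.Empty using (⊥; ⊥-elim-irr)
open import Data.Fin.Base as Fin using (Fin; toℕ; fromℕ<)
open import Data.Fin.Properties using (toℕ-injective; toℕ-fromℕ<; toℕ<n; any?; all?)
  renaming (_≟_ to _≟ᶠ_)
open import Data.Fin.Subset using () renaming (_∈_ to _∈ₛ_; _⊆_ to _⊆ₛ_)
open import Data.Fin.Subset.Properties using (nonempty?)
  renaming (_∈?_ to _∈ₛ?_; _⊆?_ to _⊆ₛ?_)
import Data.Irrelevant as Irrelevant
open import Data.List.Base
  using (List; []; _∷_; _++_; map; filter; mapMaybe; allFin; length; lookup; deduplicate)
open import Data.List.Membership.Propositional using (_∈_; _∉_; find; lose)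
import Data.List.Membership.DecPropositional as DecMembership
open import Data.List.Membership.Propositional.Properties
  using (∈-∃++; ∈-map⁺; ∈-map⁻; ∈-filter⁺; ∈-filter⁻; ∈-++⁺ˡ; ∈-++⁺ʳ; ∈-++⁻; ∈-allFin;
         ∈-lookup; ∈-deduplicate⁺; ∈-deduplicate⁻)
open import Data.List.Relation.Binary.BagAndSetEquality using (_∼[_]_; set)
open import Data.List.Relation.Binary.Permutation.Propositional as Perm using (_↭_; ↭-sym)
open import Data.List.Relation.Binary.Permutation.Propositional.Properties
  using (∈-resp-↭; shift; map⁺)
open import Data.List.Relation.Binary.Subset.Propositional using (_⊆_)
open import Data.List.Relation.Unary.All as All using (All; []; _∷_)
import Data.List.Relation.Unary.All.Properties as All
open import Data.List.Relation.Unary.AllPairs using ([]; _∷_)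
open import Data.List.Relation.Unary.Any as Any using (Any; here; there)
import Data.List.Relation.Unary.Any.Properties as Any
open import Data.List.Relation.Unary.Unique.Propositional using (Unique)
import Data.List.Relation.Unary.Unique.DecPropositional.Properties as DecUnique
import Data.List.Relation.Unary.Unique.Propositional.Properties as Unique
open import Data.Maybe.Base using (Maybe; just; nothing; maybe)
open import Data.Nat.Base
  using (ℕ; zero; suc; _+_; _*_; _∸_; _⊔_; _≤_; _<_; z≤n; s≤s)
open import Data.Nat.Induction using (Acc; acc; <-wellFounded)
open import Data.Nat.ListAction using (sum)
open import Data.Nat.ListAction.Properties using (sum-↭)
import Data.Nat.Properties as ℕ
open import Data.Product.Base using (Σ; ∃; ∃-syntax; _×_; _,_; proj₁; proj₂)
open import Data.Refinement.Base using (value; _,_)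
import Data.Refinement.Properties as Refinement
open import Data.Sum.Base as Sum using (_⊎_; inj₁; inj₂; [_,_]′)
open import Data.Unit.Base using (⊤; tt)
import Data.Vec.Functional as Vector
open import Data.Vec.Properties using () renaming (≡-dec to Vec-≡-dec)
open import Function.Base using (_∘_; id)
open import Function.Bundles using (_⇔_; _↔_; mk⇔; Equivalence; Inverse)
open import Level using (0ℓ)
open import Relation.Binary.Bundles using (TotalOrder)
open import Relation.Binary.Construct.Add.Supremum.NonStrict _≤_ as Sup
  using (_≤⁺_; [_]; _≤⊤⁺; ≤⁺-dec)
open import Relation.Binary.Definitions using (DecidableEquality)
open import Relation.Binary.PropositionalEquality
  using (_≡_; _≢_; _≗_; refl; sym; trans; cong; cong₂; subst; module ≡-Reasoning)
import Relation.Binary.Reasoning.Preorder as ≲-Reasoning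
open import Relation.Nullary
  using (¬_; Dec; yes; no; does; isYes; contradiction; ¬?; recompute)
open import Relation.Nullary.Construct.Add.Supremum using (≡-dec)
  renaming ([_] to fin; ⊤⁺ to ω)
open import Relation.Nullary.Decidable
  using (map′; _×-dec_; _→-dec_; _⊎-dec_; dec-true; decidable-stable; toWitness; fromWitness)
open import Relation.Nullary.Negation using (negated-stable)
open import Relation.Unary using (Pred; Decidable)

-- Satisfaction of ℒ-formulas cannot be decided, since `□` ranges over an arbitrary predicate `U`,
-- and neither can the finiteness of a support. Soundness therefore relies on the ¬¬-stability of
-- truth, and completeness contains no argument by contradiction: each finite set is shown to be
-- closable or open, which works because admissibility is decidable.
--
-- The tags answer a difficulty about boxes. The △-bodies false at a successor only bound its
-- distance from below, and grades built from them alone could bring it within reach of a box that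
-- its denominator ignores. Raising the distance to exactly δ, with infinite grades for agents
-- outside the group, lets a box reach a successor precisely when the equivalence in `Admissible`
-- puts the box into the label `Y`. A state that is not a successor must be out of reach of every
-- box.

_≟ω_ : DecidableEquality ℕω
_≟ω_ = ≡-dec ℕ._≟_

_≤ω?_ : ∀ x y → Dec (x ≤⁺ y)
_≤ω?_ = ≤⁺-dec ℕ._≤?_

-- Order and addition of grades

≤ω-totalOrder : TotalOrder 0ℓ 0ℓ 0ℓ
≤ω-totalOrder = record { isTotalOrder = Sup.≤⁺-isTotalOrder-≡ ℕ.≤-isTotalOrder }

≤ω-refl : ∀ {x} → x ≤⁺ x
≤ω-refl = Sup.≤⁺-reflexive-≡ ℕ.≤-reflexive refl

≤ω-trans : ∀ {x y z} → x ≤⁺ y → y ≤⁺ z → x ≤⁺ z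
≤ω-trans = Sup.≤⁺-trans ℕ.≤-trans

≤ω-antisym : ∀ {x y} → x ≤⁺ y → y ≤⁺ x → x ≡ y
≤ω-antisym = Sup.≤⁺-antisym-≡ ℕ.≤-antisym

fin0≤ : ∀ x → fin 0 ≤⁺ x
fin0≤ (fin _) = [ z≤n ]
fin0≤ ω       = _ ≤⊤⁺

≤0⇒≡0 : ∀ {x} → x ≤⁺ fin 0 → x ≡ fin 0
≤0⇒≡0 x≤0 = ≤ω-antisym x≤0 (fin0≤ _)

≤fin⇒≢ω : ∀ {x d} → x ≤⁺ fin d → x ≢ ω
≤fin⇒≢ω () refl

+ω-comm : ∀ x y → x +ω y ≡ y +ω x
+ω-comm (fin k) (fin l) = cong fin (ℕ.+-comm k l)
+ω-comm (fin _) ω       = refl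
+ω-comm ω       (fin _) = refl
+ω-comm ω       ω       = refl

+ω-assoc : ∀ x y z → (x +ω y) +ω z ≡ x +ω (y +ω z)
+ω-assoc (fin k) (fin l) (fin m) = cong fin (ℕ.+-assoc k l m)
+ω-assoc (fin _) (fin _) ω       = refl
+ω-assoc (fin _) ω       _       = refl
+ω-assoc ω       _       _       = refl

+ω-identityˡ : ∀ x → fin 0 +ω x ≡ x
+ω-identityˡ (fin _) = refl
+ω-identityˡ ω       = refl

+ω-mono-≤ : ∀ {x y u v} → x ≤⁺ y → u ≤⁺ v → x +ω u ≤⁺ y +ω v
+ω-mono-≤ {y = ω}     _     _     = _ ≤⊤⁺
+ω-mono-≤ {y = fin _} _     (_ ≤⊤⁺) = _ ≤⊤⁺
+ω-mono-≤             [ p ] [ q ] = [ ℕ.+-mono-≤ p q ]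

x≤x+ωy : ∀ x y → x ≤⁺ x +ω y
x≤x+ωy (fin k) (fin l) = [ ℕ.m≤m+n k l ]
x≤x+ωy (fin _) ω       = _ ≤⊤⁺
x≤x+ωy ω       _       = _ ≤⊤⁺

y≤x+ωy : ∀ x y → y ≤⁺ x +ω y
y≤x+ωy x y = subst (y ≤⁺_) (+ω-comm y x) (x≤x+ωy y x)

swap-middle : ∀ a b c d → (a +ω b) +ω (c +ω d) ≡ (a +ω c) +ω (b +ω d)
swap-middle a b c d = begin
  (a +ω b) +ω (c +ω d)  ≡⟨ +ω-assoc a b (c +ω d) ⟩
  a +ω (b +ω (c +ω d))  ≡⟨ cong (a +ω_) (sym (+ω-assoc b c d)) ⟩
  a +ω ((b +ω c) +ω d)  ≡⟨ cong (λ e → a +ω (e +ω d)) (+ω-comm b c) ⟩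
  a +ω ((c +ω b) +ω d)  ≡⟨ cong (a +ω_) (+ω-assoc c b d) ⟩
  a +ω (c +ω (b +ω d))  ≡⟨ sym (+ω-assoc a c (b +ω d)) ⟩
  (a +ω c) +ω (b +ω d)  ∎
  where open ≡-Reasoning

-- Only used on finite grades: ω is sent to the junk value 0.
toℕω : ℕω → ℕ
toℕω (fin k) = k
toℕω ω       = 0

fin-toℕω : ∀ {x} → x ≢ ω → fin (toℕω x) ≡ x
fin-toℕω {fin _} _   = refl
fin-toℕω {ω}     ω≢ω = contradiction refl ω≢ω

-- Finite and possibly infinite sums of grades

module _ {A : Set} where

  extract : ∀ {x : A} {xs} → x ∈ xs → ∃[ ys ] xs ↭ x ∷ ys
  extract x∈xs with ys , zs , refl ← ∈-∃++ x∈xs = _ , shift _ ys zs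

  ↭⇒∼set : ∀ {xs ys : List A} → xs ↭ ys → xs ∼[ set ] ys
  ↭⇒∼set xs↭ys = mk⇔ (∈-resp-↭ xs↭ys) (∈-resp-↭ (↭-sym xs↭ys))

  ∑ : List A → (A → ℕω) → ℕω
  ∑ xs f = sumω (map f xs)

  ∑-cong : ∀ xs {f g : A → ℕω} → (∀ {x} → x ∈ xs → f x ≡ g x) → ∑ xs f ≡ ∑ xs g
  ∑-cong []       f≗g = refl
  ∑-cong (x ∷ xs) f≗g = cong₂ _+ω_ (f≗g (here refl)) (∑-cong xs (f≗g ∘ there))

  ∑-mono : ∀ xs {f g : A → ℕω} → (∀ {x} → x ∈ xs → f x ≤⁺ g x) → ∑ xs f ≤⁺ ∑ xs g
  ∑-mono []       f≤g = ≤ω-refl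
  ∑-mono (x ∷ xs) f≤g = +ω-mono-≤ (f≤g (here refl)) (∑-mono xs (f≤g ∘ there))

  ∑-+ : ∀ xs (f g : A → ℕω) → ∑ xs (λ x → f x +ω g x) ≡ ∑ xs f +ω ∑ xs g
  ∑-+ []       f g = refl
  ∑-+ (x ∷ xs) f g = trans (cong (_ +ω_) (∑-+ xs f g)) (swap-middle (f x) (g x) _ _)

  ∑-0 : ∀ (xs : List A) → ∑ xs (λ _ → fin 0) ≡ fin 0
  ∑-0 []       = refl
  ∑-0 (_ ∷ xs) = trans (+ω-identityˡ _) (∑-0 xs)

  ∑-↭ : ∀ f {xs ys : List A} → xs ↭ ys → ∑ xs f ≡ ∑ ys f
  ∑-↭ f Perm.refl         = refl
  ∑-↭ f (Perm.prep x p)   = cong (f x +ω_) (∑-↭ f p)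
  ∑-↭ f {_ ∷ _ ∷ xs} (Perm.swap x y p) = begin
    f x +ω (f y +ω ∑ xs f)  ≡⟨ sym (+ω-assoc (f x) (f y) _) ⟩
    (f x +ω f y) +ω ∑ xs f  ≡⟨ cong₂ _+ω_ (+ω-comm (f x) (f y)) (∑-↭ f p) ⟩
    (f y +ω f x) +ω _       ≡⟨ +ω-assoc (f y) (f x) _ ⟩
    f y +ω (f x +ω _)       ∎
    where open ≡-Reasoning
  ∑-↭ f (Perm.trans p q)  = trans (∑-↭ f p) (∑-↭ f q)

  term≤∑ : ∀ f {x : A} {xs} → x ∈ xs → f x ≤⁺ ∑ xs f
  term≤∑ f {xs = _ ∷ xs} (here refl)  = x≤x+ωy _ _
  term≤∑ f {xs = y ∷ xs} (there x∈xs) = ≤ω-trans (term≤∑ f x∈xs) (y≤x+ωy (f y) _)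

  -- Since `ys` has no duplicates, each of its non-zero summands can consume an entry of `xs` of its
  -- own; what is left of `xs` only increases the right-hand sum.
  ∑-support-≤ : ∀ f {ys} → Unique ys → ∀ xs → (∀ {y : A} → y ∈ ys → f y ≢ fin 0 → y ∈ xs) →
                ∑ ys f ≤⁺ ∑ xs f
  ∑-support-≤ f []              xs _  = fin0≤ _
  ∑-support-≤ f {y ∷ ys} (y∉ys ∷ ys!) xs ⊆xs with f y ≟ω fin 0
  ... | yes fy≡0 = subst (_≤⁺ ∑ xs f) (sym (trans (cong (_+ω ∑ ys f) fy≡0) (+ω-identityˡ _)))
                     (∑-support-≤ f ys! xs (⊆xs ∘ there))
  ... | no  fy≢0 with xs′ , xs↭ ← extract (⊆xs (here refl) fy≢0) =
    subst (f y +ω ∑ ys f ≤⁺_) (sym (∑-↭ f xs↭))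
      (+ω-mono-≤ (≤ω-refl {f y}) (∑-support-≤ f ys! xs′ rest))
    where
    rest : ∀ {z} → z ∈ ys → f z ≢ fin 0 → z ∈ xs′
    rest z∈ys fz≢0 with ∈-resp-↭ xs↭ (⊆xs (there z∈ys) fz≢0)
    ... | here refl   = contradiction refl (All.lookup y∉ys z∈ys)
    ... | there z∈xs′ = z∈xs′

  SumAtMost : Pred A 0ℓ → (A → ℕω) → ℕ → Set
  SumAtMost P f d = ∃[ s ] Sum P f s × s ≤⁺ fin d

  -- The constructor `infinite` gives the value ω, which is not below `fin d`. A finite bound thus
  -- decides which constructor was used.
  finite-support : ∀ {P f d} → SumAtMost P f d →
                   ∃[ xs ] FiniteSupport P f xs × ∑ xs f ≤⁺ fin d
  finite-support (_ , finite xs fs , s≤d) = xs , fs , s≤d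

  ∑≤SumAtMost : ∀ {P f d} → SumAtMost P f d → ∀ {ys} → Unique ys →
                (∀ {y} → y ∈ ys → P y) → ∑ ys f ≤⁺ fin d
  ∑≤SumAtMost {f = f} sum ys! ysP with xs , ((_ , xs⇔) , _) , ∑≤d ← finite-support sum =
    ≤ω-trans (∑-support-≤ f ys! xs λ y∈ys fy≢0 → Equivalence.from (xs⇔ _) (ysP y∈ys , fy≢0)) ∑≤d

  term≤SumAtMost : ∀ {P f d} → SumAtMost P f d → ∀ {x} → P x → f x ≤⁺ fin d
  term≤SumAtMost {f = f} sum {x} px =
    ≤ω-trans (x≤x+ωy (f x) (fin 0)) (∑≤SumAtMost sum ([] ∷ []) λ { (here refl) → px })

  -- `xs` only has to cover the support. `FiniteSupport` wants an exact enumeration, so the zero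
  -- summands are filtered out; that no summand is ω follows from the bound.
  mkSumAtMost : ∀ {P : Pred A 0ℓ} {f d xs} → Unique xs → (∀ {x} → x ∈ xs → P x) →
                (∀ {x} → P x → f x ≢ fin 0 → x ∈ xs) → ∑ xs f ≤⁺ fin d → SumAtMost P f d
  mkSumAtMost {P} {f} {d} {xs} xs! xsP support ∑≤d =
    _ , finite xs′ ((xs′! , λ x → mk⇔ to from) , All.tabulate (≤fin⇒≢ω ∘ finite-term)) ,
    ≤ω-trans (∑-support-≤ f xs′! xs λ x∈ _ → proj₁ (∈-filter⁻ nonzero? {xs = xs} x∈)) ∑≤d
    where
    nonzero? : Decidable (λ x → f x ≢ fin 0)
    nonzero? x = ¬? (f x ≟ω fin 0)
    xs′ = filter nonzero? xs
    xs′! : Unique xs′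
    xs′! = Unique.filter⁺ nonzero? xs!
    to : ∀ {x} → x ∈ xs′ → P x × f x ≢ fin 0
    to x∈ with x∈xs , fx≢0 ← ∈-filter⁻ nonzero? {xs = xs} x∈ = xsP x∈xs , fx≢0
    from : ∀ {x} → P x × f x ≢ fin 0 → x ∈ xs′
    from (px , fx≢0) = ∈-filter⁺ nonzero? (support px fx≢0) fx≢0
    finite-term : ∀ {x} → x ∈ xs′ → f x ≤⁺ fin d
    finite-term x∈ = ≤ω-trans (term≤∑ f (proj₁ (∈-filter⁻ nonzero? {xs = xs} x∈))) ∑≤d

∑-swap : ∀ {A B : Set} xs ys (f : A → B → ℕω) →
         ∑ xs (λ x → ∑ ys (f x)) ≡ ∑ ys (λ y → ∑ xs (λ x → f x y))
∑-swap []       ys f = sym (∑-0 ys)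
∑-swap (x ∷ xs) ys f =
  trans (cong (∑ ys (f x) +ω_) (∑-swap xs ys f)) (sym (∑-+ ys (f x) _))

module _ {A : Set} where

  ∑-fin : ∀ (xs : List A) δ → ∑ xs (fin ∘ δ) ≡ fin (sum (map δ xs))
  ∑-fin []       δ = refl
  ∑-fin (x ∷ xs) δ = cong (fin (δ x) +ω_) (∑-fin xs δ)

  ∑≢0⇒term≢0 : ∀ f (xs : List A) → ∑ xs f ≢ fin 0 → ∃[ x ] x ∈ xs × f x ≢ fin 0
  ∑≢0⇒term≢0 f []       ∑≢0 = contradiction refl ∑≢0
  ∑≢0⇒term≢0 f (x ∷ xs) ∑≢0 with f x ≟ω fin 0
  ... | no  fx≢0 = x , here refl , fx≢0
  ... | yes fx≡0 with y , y∈xs , fy≢0 ← ∑≢0⇒term≢0 f xs (λ ∑≡0 → ∑≢0 (cong₂ _+ω_ fx≡0 ∑≡0)) =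
    y , there y∈xs , fy≢0

  term≢0⇒∑≢0 : ∀ f {x : A} {xs} → x ∈ xs → f x ≢ fin 0 → ∑ xs f ≢ fin 0
  term≢0⇒∑≢0 f x∈xs fx≢0 ∑≡0 = fx≢0 (≤0⇒≡0 (subst (f _ ≤⁺_) ∑≡0 (term≤∑ f x∈xs)))

  term≤sum : ∀ (δ : A → ℕ) {x xs} → x ∈ xs → δ x ≤ sum (map δ xs)
  term≤sum δ {xs = _ ∷ _}  (here refl)  = ℕ.m≤m+n _ _
  term≤sum δ {xs = y ∷ _}  (there x∈xs) = ℕ.≤-trans (term≤sum δ x∈xs) (ℕ.m≤n+m _ (δ y))

  sum-cong : ∀ (xs : List A) {δ δ′ : A → ℕ} → (∀ {x} → x ∈ xs → δ x ≡ δ′ x) →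
             sum (map δ xs) ≡ sum (map δ′ xs)
  sum-cong []       δ≗δ′ = refl
  sum-cong (x ∷ xs) δ≗δ′ = cong₂ _+_ (δ≗δ′ (here refl)) (sum-cong xs (δ≗δ′ ∘ there))

  sum-mono : ∀ (xs : List A) {δ δ′ : A → ℕ} → (∀ x → δ x ≤ δ′ x) →
             sum (map δ xs) ≤ sum (map δ′ xs)
  sum-mono []       δ≤δ′ = z≤n
  sum-mono (x ∷ xs) δ≤δ′ = ℕ.+-mono-≤ (δ≤δ′ x) (sum-mono xs δ≤δ′)

  -- The head of the list takes the whole surplus; the membership hypothesis ensures that there is a
  -- head. This turns shares of total at most k into an element of P(J,k).
  raise-sum : DecidableEquality A → ∀ {xs} → Unique xs → ∀ {x : A} → x ∈ xs →
              ∀ δ {k} → sum (map δ xs) ≤ k →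
              ∃[ δ′ ] (∀ y → δ y ≤ δ′ y) × sum (map δ′ xs) ≡ k
  raise-sum _≟_ {x ∷ xs} (x∉xs ∷ _) _ δ {k} sum≤k = δ′ , δ≤δ′ , sum≡k
    where
    rest : ℕ
    rest = sum (map δ xs)
    δ′ : A → ℕ
    δ′ y with y ≟ x
    ... | yes _ = k ∸ rest
    ... | no  _ = δ y
    δ≤δ′ : ∀ y → δ y ≤ δ′ y
    δ≤δ′ y with y ≟ x
    ... | yes refl = ℕ.m+n≤o⇒m≤o∸n (δ x) sum≤k
    ... | no  _    = ℕ.≤-refl
    δ′x : δ′ x ≡ k ∸ rest
    δ′x with x ≟ x
    ... | yes _  = refl
    ... | no x≢x = contradiction refl x≢x
    δ′-rest : ∀ {y} → y ∈ xs → δ′ y ≡ δ y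
    δ′-rest {y} y∈xs with y ≟ x
    ... | yes refl = contradiction refl (All.lookup x∉xs y∈xs)
    ... | no  _    = refl
    sum≡k : sum (map δ′ (x ∷ xs)) ≡ k
    sum≡k = trans (cong₂ _+_ δ′x (sum-cong xs δ′-rest))
                  (ℕ.m∸n+n≡m (ℕ.≤-trans (ℕ.m≤n+m rest (δ x)) sum≤k))

-- Lists, bounded search and node names

open import Data.List.Extrema ≤ω-totalOrder using (max; v≤max⁺; argmax-sel)

∈-mapMaybe⁺ : ∀ {A B : Set} (f : A → Maybe B) {x y xs} → x ∈ xs → f x ≡ just y → y ∈ mapMaybe f xs
∈-mapMaybe⁺ f {x} (here refl) fx≡ with f x | fx≡
... | just _ | refl = here refl
∈-mapMaybe⁺ f {xs = z ∷ _} (there x∈xs) fx≡ with f z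
... | just _  = there (∈-mapMaybe⁺ f x∈xs fx≡)
... | nothing = ∈-mapMaybe⁺ f x∈xs fx≡

∈-mapMaybe⁻ : ∀ {A B : Set} (f : A → Maybe B) {y} xs → y ∈ mapMaybe f xs →
              ∃[ x ] x ∈ xs × f x ≡ just y
∈-mapMaybe⁻ f (x ∷ xs) y∈ with f x in fx≡
... | nothing with z , z∈xs , fz≡ ← ∈-mapMaybe⁻ f xs y∈ = z , there z∈xs , fz≡
∈-mapMaybe⁻ f (x ∷ xs) (here refl) | just _ = x , here refl , fx≡
∈-mapMaybe⁻ f (x ∷ xs) (there y∈) | just _
  with z , z∈xs , fz≡ ← ∈-mapMaybe⁻ f xs y∈ = z , there z∈xs , fz≡

≤⇒∃+ω : ∀ {x y} → x ≤⁺ y → ∃[ t ] y ≡ x +ω t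
≤⇒∃+ω {fin k} [ k≤l ]       = fin (_ ∸ k) , cong fin (sym (ℕ.m+[n∸m]≡n k≤l))
≤⇒∃+ω {fin _} (_ ≤⊤⁺)       = ω , refl
≤⇒∃+ω {ω}     (_ ≤⊤⁺)       = ω , refl

_⇔-dec_ : ∀ {A B : Set} → Dec A → Dec B → Dec (A ⇔ B)
a? ⇔-dec b? = map′ (λ (f , g) → mk⇔ f g) (λ e → Equivalence.to e , Equivalence.from e)
                   ((a? →-dec b?) ×-dec (b? →-dec a?))

-- The search rebuilds a function from its finitely many values and so finds it only up to pointwise
-- equality, which `P` has to respect.
bounded-∃? : ∀ {m} k {P : (Fin m → ℕ) → Set} → (∀ {δ δ′} → δ ≗ δ′ → P δ → P δ′) →
             (∀ δ → Dec (P δ)) → Dec (∃[ δ ] (∀ i → δ i ≤ k) × P δ)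
bounded-∃? {zero} k resp P? =
  map′ (λ p → Vector.[] , (λ ()) , p) (λ (_ , _ , p) → resp (λ ()) p) (P? Vector.[])
bounded-∃? {suc m} k {P} resp P? =
  map′ (λ (a , δ , δ≤k , p) →
          toℕ a Vector.∷ δ , (λ { Fin.zero → ℕ.≤-pred (toℕ<n a) ; (Fin.suc i) → δ≤k i }) , p)
       (λ (δ , δ≤k , p) → fromℕ< (s≤s (δ≤k Fin.zero)) , δ ∘ Fin.suc , δ≤k ∘ Fin.suc ,
          resp (λ { Fin.zero → sym (toℕ-fromℕ< (s≤s (δ≤k Fin.zero))) ; (Fin.suc i) → refl }) p)
       (any? λ a → bounded-∃? k
          (λ δ≗δ′ → resp λ { Fin.zero → refl ; (Fin.suc i) → δ≗δ′ i })
          (λ δ → P? (toℕ a Vector.∷ δ)))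

Max⁰-cong : ∀ {Z Z′ : Pred ℕω 0ℓ} {m} → (∀ {g} → Z g → Z′ g) → (∀ {g} → Z′ g → Z g) →
            Max⁰ Z m → Max⁰ Z′ m
Max⁰-cong to from (inj₁ ≡0 , upper) = inj₁ ≡0 , λ g → upper g ∘ from
Max⁰-cong to from (inj₂ zm , upper) = inj₂ (to zm) , λ g → upper g ∘ from

module _ {A : Set} where

  all-or-any : ∀ {P Q : A → Set} {xs} → All (λ x → P x ⊎ Q x) xs → All P xs ⊎ Any Q xs
  all-or-any []            = inj₁ []
  all-or-any (inj₂ q ∷ _)  = inj₂ (here q)
  all-or-any (inj₁ p ∷ pqs) with all-or-any pqs
  ... | inj₁ ps = inj₁ (p ∷ ps)
  ... | inj₂ qs = inj₂ (there qs)

  -- A numerator is read up to set equality, so the principal formula may stay among the remaining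
  -- ones. In this way □-elim is applied with all of Γ as `X`; `unbox` discards the extra ¬□.
  absorb : ∀ {x} {xs : List A} → x ∈ xs → xs ∼[ set ] (x ∷ xs)
  absorb x∈xs = mk⇔ there λ { (here refl) → x∈xs ; (there y∈xs) → y∈xs }

  absorb₂ : ∀ {x y} {xs : List A} → x ∈ xs → y ∈ xs → xs ∼[ set ] (x ∷ y ∷ xs)
  absorb₂ x∈xs y∈xs = mk⇔ (there ∘ there)
    λ { (here refl) → x∈xs ; (there (here refl)) → y∈xs ; (there (there z∈xs)) → z∈xs }

  subsequences : List A → List (List A)
  subsequences []       = [] ∷ []
  subsequences (x ∷ xs) = map (x ∷_) (subsequences xs) ++ subsequences xs

  -- Up to set equality every subset of `xs` is a filter of `xs`, so the subsequences are a complete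
  -- finite list of candidate labels for □-elim.
  filter∈subsequences : ∀ {P : Pred A 0ℓ} (P? : Decidable P) xs → filter P? xs ∈ subsequences xs
  filter∈subsequences P? [] = here refl
  filter∈subsequences P? (x ∷ xs) with does (P? x)
  ... | true  = ∈-++⁺ˡ (∈-map⁺ (x ∷_) (filter∈subsequences P? xs))
  ... | false = ∈-++⁺ʳ _ (filter∈subsequences P? xs)

  subsequences-⊆ : ∀ {ys} xs → ys ∈ subsequences xs → ys ⊆ xs
  subsequences-⊆ [] (here refl) y∈ = y∈
  subsequences-⊆ (x ∷ xs) ys∈ y∈ with ∈-++⁻ (map (x ∷_) (subsequences xs)) ys∈
  ... | inj₂ ys∈′ = there (subsequences-⊆ xs ys∈′ y∈)
  ... | inj₁ x∷∈ with _ , zs∈ , refl ← ∈-map⁻ (x ∷_) x∷∈ with y∈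
  ...   | here refl = here refl
  ...   | there z∈  = there (subsequences-⊆ xs zs∈ z∈)

  -- This is why the candidates are subsequences: a list that is merely `⊆ xs` may repeat entries
  -- and have a larger sum.
  subsequences-sum : ∀ (f : A → ℕ) {ys} xs → ys ∈ subsequences xs →
                     sum (map f ys) ≤ sum (map f xs)
  subsequences-sum f [] (here refl) = z≤n
  subsequences-sum f (x ∷ xs) ys∈ with ∈-++⁻ (map (x ∷_) (subsequences xs)) ys∈
  ... | inj₂ ys∈′ = ℕ.≤-trans (subsequences-sum f xs ys∈′) (ℕ.m≤n+m _ (f x))
  ... | inj₁ x∷∈ with _ , zs∈ , refl ← ∈-map⁻ (x ∷_) x∷∈ =
    ℕ.+-monoʳ-≤ (f x) (subsequences-sum f xs zs∈)

-- The pair (j , c) is coded as 2^j (2 c + 1), which is never 0.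
childName : ℕ → ℕ → ℕ
childName zero    c = suc (2 * c)
childName (suc j) c = 2 * childName j c

-- The name 0 is reserved for the root.
childName≢0 : ∀ j c → childName j c ≢ 0
childName≢0 (suc j) c 2*≡0 = childName≢0 j c (ℕ.*-cancelˡ-≡ _ 0 2 2*≡0)

-- Parity tells whether j is 0, and halving reduces j by one. By iteration a name determines the
-- whole path from the root.
childName-injective : ∀ j c j′ c′ → childName j c ≡ childName j′ c′ → j ≡ j′ × c ≡ c′
childName-injective zero    c zero     c′ eq = refl , ℕ.*-cancelˡ-≡ c c′ 2 (ℕ.suc-injective eq)
childName-injective zero    c (suc j′) c′ eq = contradiction (sym eq) (ℕ.even≢odd (childName j′ c′) c)
childName-injective (suc j) c zero     c′ eq = contradiction eq (ℕ.even≢odd (childName j c) c′)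
childName-injective (suc j) c (suc j′) c′ eq
  with refl , refl ← childName-injective j c j′ c′ (ℕ.*-cancelˡ-≡ _ _ 2 eq) = refl , refl

module Tableaux (Atm : Set) (Atm↔ℕ : Atm ↔ ℕ) (n : ℕ) where

  open LGDDA Atm Atm↔ℕ n

  open Inverse Atm↔ℕ using () renaming (to to atomIndex; from to atomAt)

  -- Decidable equality of formulas; members of groups

  atomIndex-injective : ∀ {p q} → atomIndex p ≡ atomIndex q → p ≡ q
  atomIndex-injective {p} {q} eq =
    trans (sym (Inverse.strictlyInverseʳ Atm↔ℕ p))
          (trans (cong atomAt eq) (Inverse.strictlyInverseʳ Atm↔ℕ q))

  _≟ᵃ_ : DecidableEquality Atm
  p ≟ᵃ q = map′ atomIndex-injective (cong atomIndex) (atomIndex p ℕ.≟ atomIndex q)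

  _≟ᵍ_ : DecidableEquality ℕ₁ω
  _≟ᵍ_ = Refinement._≟_ _≟ω_

  _≟ʲ_ : DecidableEquality Group
  _≟ʲ_ = Refinement._≟_ (Vec-≡-dec _≟ᵇ_)

  infix 4 _≟_ _∈?_

  _≟_ : ∀ {l} → DecidableEquality (Formula l)
  atom p ≟ atom q = map′ (cong atom) (λ { refl → refl }) (p ≟ᵃ q)
  (¬' φ) ≟ (¬' ψ) = map′ (cong ¬'_) (λ { refl → refl }) (φ ≟ ψ)
  (φ₁ ∧' φ₂) ≟ (ψ₁ ∧' ψ₂) =
    map′ (λ { (refl , refl) → refl }) (λ { refl → refl , refl }) (φ₁ ≟ ψ₁ ×-dec φ₂ ≟ ψ₂)
  △ i k α ≟ △ j l β =
    map′ (λ { (refl , refl , refl) → refl }) (λ { refl → refl , refl , refl })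
         (i ≟ᶠ j ×-dec k ≟ᵍ l ×-dec α ≟ β)
  □ J k φ ≟ □ J′ k′ ψ =
    map′ (λ { (refl , refl , refl) → refl }) (λ { refl → refl , refl , refl })
         (J ≟ʲ J′ ×-dec k ℕ.≟ k′ ×-dec φ ≟ ψ)
  atom _   ≟ (¬' _)   = no λ ()
  atom _   ≟ (_ ∧' _) = no λ ()
  atom _   ≟ △ _ _ _  = no λ ()
  atom _   ≟ □ _ _ _  = no λ ()
  (¬' _)   ≟ atom _   = no λ ()
  (¬' _)   ≟ (_ ∧' _) = no λ ()
  (¬' _)   ≟ △ _ _ _  = no λ ()
  (¬' _)   ≟ □ _ _ _  = no λ ()
  (_ ∧' _) ≟ atom _   = no λ ()
  (_ ∧' _) ≟ (¬' _)   = no λ ()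
  (_ ∧' _) ≟ △ _ _ _  = no λ ()
  (_ ∧' _) ≟ □ _ _ _  = no λ ()
  △ _ _ _  ≟ atom _   = no λ ()
  △ _ _ _  ≟ (¬' _)   = no λ ()
  △ _ _ _  ≟ (_ ∧' _) = no λ ()
  △ _ _ _  ≟ □ _ _ _  = no λ ()
  □ _ _ _  ≟ atom _   = no λ ()
  □ _ _ _  ≟ (¬' _)   = no λ ()
  □ _ _ _  ≟ (_ ∧' _) = no λ ()
  □ _ _ _  ≟ △ _ _ _  = no λ ()

  _∈?_ : ∀ {l} (φ : Formula l) Γ → Dec (φ ∈ Γ)
  _∈?_ = DecMembership._∈?_ _≟_

  members-! : ∀ J → Unique (members J)
  members-! J = Unique.filter⁺ (_∈ₛ? value J) (Unique.allFin⁺ n)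

  ∈-members⁺ : ∀ J {i} → i ∈ₛ value J → i ∈ members J
  ∈-members⁺ J = ∈-filter⁺ (_∈ₛ? value J) (∈-allFin _)

  ∈-members⁻ : ∀ J {i} → i ∈ members J → i ∈ₛ value J
  ∈-members⁻ J = proj₂ ∘ ∈-filter⁻ (_∈ₛ? value J) {xs = allFin n}

  -- A group stores its non-emptiness irrelevantly; a usable witness is recovered because
  -- non-emptiness is decidable.
  inhabitant : (J : Group) → ∃[ i ] i ∈ₛ value J
  inhabitant (J , Irrelevant.[ nonempty ]) = recompute (nonempty? J) nonempty

  -- Truth and distance

  ⊨₀-dec : ∀ S α → Dec (S ⊨₀ α)
  ⊨₀-dec S (atom p)  = T? (val S p)
  ⊨₀-dec S (¬' α)    = ¬? (⊨₀-dec S α)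
  ⊨₀-dec S (α ∧' β)  = ⊨₀-dec S α ×-dec ⊨₀-dec S β
  ⊨₀-dec S (△ i k α) = value k ≤ω? base S i α

  -- The substitute for excluded middle in the soundness proof. It rests on Boolean valuations and
  -- decidable grades; a box inherits stability from the formula inside it.
  ⊨-stable : ∀ S U φ → ¬ ¬ (S , U ⊨ φ) → S , U ⊨ φ
  ⊨-stable S U (atom p)  ¬¬h = decidable-stable (T? (val S p)) ¬¬h
  ⊨-stable S U (¬' φ)    ¬¬h = negated-stable ¬¬h
  ⊨-stable S U (φ ∧' ψ)  ¬¬h =
    ⊨-stable S U φ (λ ¬φ → ¬¬h (¬φ ∘ proj₁)) , ⊨-stable S U ψ (λ ¬ψ → ¬¬h (¬ψ ∘ proj₂))
  ⊨-stable S U (△ i k α) ¬¬h = decidable-stable (value k ≤ω? base S i α) ¬¬h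
  ⊨-stable S U (□ J k φ) ¬¬h S′ S′∈U r =
    ⊨-stable S′ U φ λ ¬φ → ¬¬h λ □φ → ¬φ (□φ S′ S′∈U r)

  Falsified : State → Pred ℒ₀ 0ℓ
  Falsified S α = ¬ (S ⊨₀ α)

  -- `R` sums over formulas first. Exchanging the sums exhibits the share of each agent, which is
  -- what a distribution δ has to bound.
  distance≤ : ∀ {J k S S′ αs} → R J k S S′ → Unique αs → (∀ {α} → α ∈ αs → Falsified S′ α) →
              ∑ (members J) (λ i → ∑ αs (base S i)) ≤⁺ fin k
  distance≤ {J} {S = S} {αs = αs} r αs! falsified =
    subst (_≤⁺ fin _) (∑-swap αs (members J) (λ α i → base S i α)) (∑≤SumAtMost r αs! falsified)

  mkR : ∀ {J k S S′ αs} (δ : Agt → ℕ) → Unique αs → (∀ {α} → α ∈ αs → Falsified S′ α) →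
        (∀ {i α} → i ∈ₛ value J → Falsified S′ α → base S i α ≢ fin 0 → α ∈ αs) →
        (∀ {i} → i ∈ₛ value J → ∑ αs (base S i) ≤⁺ fin (δ i)) →
        sumOver J δ ≤ k → R J k S S′
  mkR {J} {k} {S} {S′} {αs} δ αs! falsified support ∑≤δ sum≤k =
    mkSumAtMost αs! falsified support′ (begin
      ∑ αs (groupBase S J)                     ≡⟨ ∑-swap αs (members J) (λ α i → base S i α) ⟩
      ∑ (members J) (λ i → ∑ αs (base S i))    ≲⟨ ∑-mono (members J) (∑≤δ ∘ ∈-members⁻ J) ⟩
      ∑ (members J) (fin ∘ δ)                  ≡⟨ ∑-fin (members J) δ ⟩
      fin (sumOver J δ)                        ≲⟨ [ sum≤k ] ⟩
      fin k                                    ∎)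
    where
    open ≲-Reasoning (TotalOrder.preorder ≤ω-totalOrder)
    support′ : ∀ {α} → Falsified S′ α → groupBase S J α ≢ fin 0 → α ∈ αs
    support′ {α} ⊭α ≢0 with i , i∈J , ≢0′ ← ∑≢0⇒term≢0 (λ i → base S i α) (members J) ≢0 =
      support (∈-members⁻ J i∈J) ⊭α ≢0′

  -- Grades demanded by a finite set

  grade : Agt → ℒ₀ → ℒ → ℕω
  grade i α (△ j k β) = if does (i ≟ᶠ j ×-dec α ≟ β) then value k else fin 0
  grade i α _         = fin 0

  -- The computable counterpart of the relation `Max⁰`: formulas other than △-formulas for i and α
  -- contribute the neutral value 0.
  maxGrade : FinSet → Agt → ℒ₀ → ℕω
  maxGrade X i α = max (fin 0) (map (grade i α) X)

  grade-△ : ∀ i α k → grade i α (△ i k α) ≡ value k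
  grade-△ i α k =
    cong (if_then value k else fin 0) (dec-true (i ≟ᶠ i ×-dec α ≟ α) (refl , refl))

  grade≢0 : ∀ i α χ → grade i α χ ≡ fin 0 ⊎ (∃[ k ] χ ≡ △ i k α × grade i α χ ≡ value k)
  grade≢0 i α (atom _)   = inj₁ refl
  grade≢0 i α (¬' _)     = inj₁ refl
  grade≢0 i α (_ ∧' _)   = inj₁ refl
  grade≢0 i α (□ _ _ _)  = inj₁ refl
  grade≢0 i α (△ j k β) with i ≟ᶠ j | α ≟ β
  ... | yes refl | yes refl = inj₂ (k , refl , refl)
  ... | yes _    | no _     = inj₁ refl
  ... | no _     | _        = inj₁ refl

  △∈⇒≤maxGrade : ∀ {X i k α} → △ i k α ∈ X → value k ≤⁺ maxGrade X i α
  △∈⇒≤maxGrade {X} {i} {k} {α} △∈X =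
    v≤max⁺ (fin 0) _ (inj₂ (Any.map
      (λ { refl → subst (value k ≤⁺_) (sym (grade-△ i α k)) ≤ω-refl })
      (∈-map⁺ (grade i α) △∈X)))

  maxGrade-attained : ∀ X i α → maxGrade X i α ≡ fin 0 ⊎
                      (∃[ k ] value k ≡ maxGrade X i α × △ i k α ∈ X)
  maxGrade-attained X i α with argmax-sel id (fin 0) (map (grade i α) X)
  ... | inj₁ ≡0 = inj₁ ≡0
  ... | inj₂ max∈ with χ , χ∈X , max≡ ← ∈-map⁻ (grade i α) max∈ | grade≢0 i α χ
  ...   | inj₁ ≡0              = inj₁ (trans max≡ ≡0)
  ...   | inj₂ (k , refl , ≡k) = inj₂ (k , sym (trans max≡ ≡k) , χ∈X)

  maxGrade≤ : ∀ X i α {m} → (∀ {k} → △ i k α ∈ X → value k ≤⁺ m) → maxGrade X i α ≤⁺ m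
  maxGrade≤ X i α bound with maxGrade-attained X i α
  ... | inj₁ ≡0            = subst (_≤⁺ _) (sym ≡0) (fin0≤ _)
  ... | inj₂ (k , ≡m , △∈) = subst (_≤⁺ _) ≡m (bound △∈)

  dropped : FinSet → FinSet → FinSet
  dropped X Y = filter (λ χ → ¬? (χ ∈? Y)) X

  droppedGrade : FinSet → FinSet → Agt → ℒ₀ → ℕω
  droppedGrade X Y = maxGrade (dropped X Y)

  ∈-dropped⁺ : ∀ {X Y χ} → χ ∈ X → χ ∉ Y → χ ∈ dropped X Y
  ∈-dropped⁺ {Y = Y} = ∈-filter⁺ (λ χ → ¬? (χ ∈? Y))

  ∈-dropped⁻ : ∀ X Y {χ} → χ ∈ dropped X Y → χ ∈ X × χ ∉ Y
  ∈-dropped⁻ X Y = ∈-filter⁻ (λ χ → ¬? (χ ∈? Y)) {xs = X}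

  droppedGrade-max : ∀ X Y i α → Max⁰ (DroppedGrade X Y i α) (droppedGrade X Y i α)
  droppedGrade-max X Y i α = attained ,
    λ { _ (k , refl , △∈X , △∉Y) → △∈⇒≤maxGrade (∈-dropped⁺ △∈X △∉Y) }
    where
    attained : droppedGrade X Y i α ≡ fin 0 ⊎ DroppedGrade X Y i α (droppedGrade X Y i α)
    attained with maxGrade-attained (dropped X Y) i α
    ... | inj₁ ≡0            = inj₁ ≡0
    ... | inj₂ (k , ≡m , △∈) = inj₂ (k , ≡m , ∈-dropped⁻ X Y △∈)

  Max⁰-unique : ∀ {Z m m′} → Max⁰ Z m → Max⁰ Z m′ → m ≡ m′
  Max⁰-unique (sel , upper) (sel′ , upper′) = ≤ω-antisym (below sel upper′) (below sel′ upper)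
    where
    below : ∀ {Z : Pred ℕω 0ℓ} {x y} → x ≡ fin 0 ⊎ Z x → (∀ k → Z k → k ≤⁺ y) → x ≤⁺ y
    below (inj₁ refl) _     = fin0≤ _
    below (inj₂ zx)   upper = upper _ zx

  -- Admissibility and denominators

  AgentAdmissible : Group → FinSet → FinSet → (Agt → ℕ) → Set
  AgentAdmissible J X Y δ = ∀ i → i ∈ₛ value J →
    Σ (ℒ₀ → ℕω) λ f → (∀ α → Max⁰ (DroppedGrade X Y i α) (f α)) × SumAtMost (λ _ → ⊤) f (δ i)

  BoxesAdmissible : Group → FinSet → FinSet → (Agt → ℕ) → Set
  BoxesAdmissible J X Y δ = ∀ J′ k′ ψ → □ J′ k′ ψ ∈ X →
    □ J′ k′ ψ ∈ Y ⇔ (value J′ ⊆ₛ value J × sumOver J′ δ ≤ k′)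

  AdmissibleAt : Group → ℕ → FinSet → FinSet → (Agt → ℕ) → Set
  AdmissibleAt J k X Y δ =
    Distribution J k δ × BoxesAdmissible J X Y δ × AgentAdmissible J X Y δ

  □-denominator : ∀ {J φ Y J′ k′ ψ} → □ J′ k′ ψ ∈ Y → ψ ∈ denominator J φ Y
  □-denominator {J} □∈Y = there (∈-mapMaybe⁺ (unbox J) □∈Y refl)

  △-denominator : ∀ {J φ Y i k α} → i ∈ₛ value J → △ i k α ∈ Y → ↑ α ∈ denominator J φ Y
  △-denominator {J} {i = i} {k = k} {α = α} i∈J △∈Y = there (∈-mapMaybe⁺ (unbox J) △∈Y unbox-△)
    where
    unbox-△ : unbox J (△ i k α) ≡ just (↑ α)
    unbox-△ rewrite dec-true (i ∈ₛ? value J) i∈J = refl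

  denominator-elim : ∀ {J φ Y χ} → χ ∈ denominator J φ Y →
                     χ ≡ ¬' φ ⊎ (∃[ J′ ] ∃[ k ] □ J′ k χ ∈ Y) ⊎
                     (∃[ i ] ∃[ k ] ∃[ α ] i ∈ₛ value J × △ i k α ∈ Y × χ ≡ ↑ α)
  denominator-elim (here refl) = inj₁ refl
  denominator-elim {J} {Y = Y} (there χ∈) with ∈-mapMaybe⁻ (unbox J) Y χ∈
  ... | □ J′ k ψ , □∈Y , refl = inj₂ (inj₁ (J′ , k , □∈Y))
  ... | △ i k α , △∈Y , eq with i ∈ₛ? value J
  denominator-elim _ | △ i k α , △∈Y , refl | yes i∈J = inj₂ (inj₂ (i , k , α , i∈J , △∈Y , refl))

  -- Soundness

  Satisfies : State → Pred State 0ℓ → FinSet → Set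
  Satisfies S U Γ = ∀ {χ} → χ ∈ Γ → S , U ⊨ χ

  ↑-intro : ∀ S U α → S ⊨₀ α → S , U ⊨ ↑ α
  ↑-intro S U α = subst id (sym (⊨-↑ S U α))

  ↑-elim : ∀ S U α → S , U ⊨ ↑ α → S ⊨₀ α
  ↑-elim S U α = subst id (⊨-↑ S U α)

  -- One list `αs` of formulas false at S′ supports the grades of all agents of J at once, and δ
  -- sums to exactly k. Both restrict to any subgroup of J, as the boxes in a label require.
  record Distances (J : Group) (k : ℕ) (S S′ : State) : Set where
    field
      αs        : List ℒ₀
      αs!       : Unique αs
      falsified : ∀ {α} → α ∈ αs → Falsified S′ α
      support   : ∀ {i α} → i ∈ₛ value J → Falsified S′ α → base S i α ≢ fin 0 → α ∈ αs
      δ         : Agt → ℕ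
      ∑≤δ       : ∀ {i} → i ∈ₛ value J → ∑ αs (base S i) ≤⁺ fin (δ i)
      sum≡k     : sumOver J δ ≡ k

  distances : ∀ {J k S S′} → R J k S S′ → Distances J k S S′
  distances {J} {k} {S} {S′} r with αs , ((αs! , αs⇔) , _) , _ ← finite-support r = record
    { αs = αs ; αs! = αs! ; falsified = falsified ; support = support
    ; δ = proj₁ raised ; ∑≤δ = ∑≤δ ; sum≡k = proj₂ (proj₂ raised) }
    where
    falsified : ∀ {α} → α ∈ αs → Falsified S′ α
    falsified α∈ = proj₁ (Equivalence.to (αs⇔ _) α∈)

    support : ∀ {i α} → i ∈ₛ value J → Falsified S′ α → base S i α ≢ fin 0 → α ∈ αs
    support i∈J ⊭α ≢0 =
      Equivalence.from (αs⇔ _) (⊭α , term≢0⇒∑≢0 _ (∈-members⁺ J i∈J) ≢0)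

    total : ∑ (members J) (λ i → ∑ αs (base S i)) ≤⁺ fin k
    total = distance≤ {J} {k} {S} {S′} r αs! falsified

    δ₀ : Agt → ℕ
    δ₀ i = toℕω (∑ αs (base S i))

    -- Each share is below the finite total, so the junk value of `toℕω` does not arise.
    fin-δ₀ : ∀ {i} → i ∈ₛ value J → fin (δ₀ i) ≡ ∑ αs (base S i)
    fin-δ₀ i∈J = fin-toℕω (≤fin⇒≢ω
      (≤ω-trans (term≤∑ (λ i → ∑ αs (base S i)) (∈-members⁺ J i∈J)) total))

    sum-δ₀ : sumOver J δ₀ ≤ k
    sum-δ₀ = Sup.[≤]-injective (subst (_≤⁺ fin k)
      (trans (sym (∑-cong (members J) (fin-δ₀ ∘ ∈-members⁻ J))) (∑-fin (members J) δ₀)) total)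

    -- P(J,k) asks for the sum k itself; J is non-empty, so some agent can absorb the surplus.
    raised : ∃[ δ ] (∀ i → δ₀ i ≤ δ i) × sumOver J δ ≡ k
    raised = raise-sum _≟ᶠ_ (members-! J) (∈-members⁺ J (proj₂ (inhabitant J))) δ₀ sum-δ₀

    ∑≤δ : ∀ {i} → i ∈ₛ value J → ∑ αs (base S i) ≤⁺ fin (proj₁ raised i)
    ∑≤δ {i} i∈J = subst (_≤⁺ fin (proj₁ raised i)) (fin-δ₀ i∈J) [ proj₁ (proj₂ raised) _ ]

  -- The label is read off S′: the boxes that apply at δ and the △-formulas whose body is true at
  -- S′. A dropped △-formula then has a false body, and S gives this body at least the demanded
  -- grade, so the dropped grades are paid for by the distance.
  module Step {X : FinSet} {J : Group} {k : ℕ} {φ : ℒ} {S S′ : State} {U : Pred State 0ℓ}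
              (⊨X : Satisfies S U X) (S′∈U : U S′) (d : Distances J k S S′)
              (⊭φ : ¬ (S′ , U ⊨ φ)) where

    open Distances d

    private
      Kept : ℒ → Set
      Kept (□ J′ k′ _) = value J′ ⊆ₛ value J × sumOver J′ δ ≤ k′
      Kept (△ _ _ α)   = S′ ⊨₀ α
      Kept _           = ⊤

      kept? : Decidable Kept
      kept? (□ J′ k′ _) = value J′ ⊆ₛ? value J ×-dec sumOver J′ δ ℕ.≤? k′
      kept? (△ _ _ α)   = ⊨₀-dec S′ α
      kept? (atom _)    = yes tt
      kept? (¬' _)      = yes tt
      kept? (_ ∧' _)    = yes tt

    Y : FinSet
    Y = filter kept? X

    Y⊆X : Y ⊆ X
    Y⊆X = proj₁ ∘ ∈-filter⁻ kept? {xs = X}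

    private
      Y-kept : ∀ {χ} → χ ∈ Y → Kept χ
      Y-kept = proj₂ ∘ ∈-filter⁻ kept? {xs = X}

      agents : AgentAdmissible J X Y δ
      agents i i∈J = f , droppedGrade-max X Y i , mkSumAtMost αs! (λ _ → tt) (λ _ → f-support)
        (≤ω-trans (∑-mono αs λ {α} _ → f≤base α) (∑≤δ i∈J))
        where
        f = droppedGrade X Y i
        f≤base : ∀ α → f α ≤⁺ base S i α
        f≤base α = maxGrade≤ (dropped X Y) i α (⊨X ∘ proj₁ ∘ ∈-dropped⁻ X Y)
        f-support : ∀ {α} → f α ≢ fin 0 → α ∈ αs
        f-support {α} f≢0 with maxGrade-attained (dropped X Y) i α
        ... | inj₁ ≡0 = contradiction ≡0 f≢0
        ... | inj₂ (_ , _ , △∈) with △∈X , △∉Y ← ∈-dropped⁻ X Y △∈ =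
          support i∈J (λ ⊨α → △∉Y (∈-filter⁺ kept? △∈X ⊨α))
            (λ ≡0 → f≢0 (≤0⇒≡0 (subst (f α ≤⁺_) ≡0 (f≤base α))))

    admissible : Admissible J k X Y
    admissible = δ , sum≡k ,
      (λ J′ k′ ψ □∈X → mk⇔ Y-kept (∈-filter⁺ kept? □∈X)) , agents

    ⊨denominator : Satisfies S′ U (denominator J φ Y)
    ⊨denominator χ∈ with denominator-elim χ∈
    ... | inj₁ refl = ⊭φ
    ... | inj₂ (inj₂ (i , k , α , _ , △∈Y , refl)) = ↑-intro S′ U α (Y-kept △∈Y)
    ... | inj₂ (inj₁ (J′ , k′ , □∈Y)) with J′⊆J , sum≤k′ ← Y-kept □∈Y =
      -- S′ is close enough for J′ as well: the shares of its agents are below δ, and δ sums over J′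
      -- to at most k′.
      ⊨X (Y⊆X □∈Y) S′ S′∈U
        (mkR {J = J′} {k = k′} {S = S} {S′} δ αs! falsified (support ∘ J′⊆J) (∑≤δ ∘ J′⊆J) sum≤k′)

  ∷-satisfies : ∀ {S U φ X} → S , U ⊨ φ → Satisfies S U X → Satisfies S U (φ ∷ X)
  ∷-satisfies ⊨φ ⊨X (here refl) = ⊨φ
  ∷-satisfies ⊨φ ⊨X (there χ∈)  = ⊨X χ∈

  ⊥'-unsatisfiable : ∀ {S U} → ¬ (S , U ⊨ ⊥')
  ⊥'-unsatisfiable (⊨p , ⊭p) = ⊭p ⊨p

  -- The claim covers all states at once, because □-elim passes from S to some other S′.
  sound : ∀ {Γ} (t : Tableau Γ) → Closed t → ∀ {S U} → ¬ Satisfies S U Γ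
  sound-any : ∀ {Ds} (ts : All Tableau Ds) → AllClosed ts → ∀ {D} → Any (D ∼[ set ]_) Ds →
              ∀ {S U} → ¬ Satisfies S U D

  sound (leaf Γ) ⊥∈Γ {S} {U} ⊨Γ = ⊥'-unsatisfiable {S} {U} (⊨Γ ⊥∈Γ)
  sound (node (¬¬-rule {φ} Γ∼) (t ∷ [])) (c , _) {S} {U} ⊨Γ =
    sound t c (∷-satisfies (⊨-stable S U φ (⊨X (here refl))) (⊨X ∘ there))
    where
    ⊨X = λ {χ} → ⊨Γ {χ} ∘ Equivalence.from Γ∼
  sound (node (∧-rule Γ∼) (t ∷ [])) (c , _) ⊨Γ =
    sound t c (∷-satisfies (proj₁ (⊨X (here refl)))
                (∷-satisfies (proj₂ (⊨X (here refl))) (⊨X ∘ there)))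
    where
    ⊨X = λ {χ} → ⊨Γ {χ} ∘ Equivalence.from Γ∼
  sound (node (¬∧-rule Γ∼) (t ∷ u ∷ [])) (c , d , _) ⊨Γ =
    sound t c (∷-satisfies (λ ⊨φ →
      sound u d (∷-satisfies (λ ⊨ψ → ⊨X (here refl) (⊨φ , ⊨ψ)) (⊨X ∘ there))) (⊨X ∘ there))
    where
    ⊨X = λ {χ} → ⊨Γ {χ} ∘ Equivalence.from Γ∼
  sound (node (⊥-rule Γ∼) ts) _ ⊨Γ = ⊨X (there (here refl)) (⊨X (here refl))
    where
    ⊨X = λ {χ} → ⊨Γ {χ} ∘ Equivalence.from Γ∼
  sound (node (△-mon k k⁺ t k⁺≡ Γ∼) ts) _ ⊨Γ =
    ⊨X (there (here refl)) (≤ω-trans (subst (value k ≤⁺_) (sym k⁺≡) (x≤x+ωy _ t)) (⊨X (here refl)))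
    where
    ⊨X = λ {χ} → ⊨Γ {χ} ∘ Equivalence.from Γ∼
  sound (node (□-elim {φ = φ} Ds Γ∼ Ds⇔) ts) cs {S} {U} ⊨Γ =
    ⊨X (here refl) λ S′ S′∈U r → ⊨-stable S′ U φ λ ⊭φ →
      let open Step {φ = φ} (⊨X ∘ there) S′∈U (distances r) ⊭φ in
      sound-any ts cs (Equivalence.from (Ds⇔ _) (Y , Y⊆X , admissible , mk⇔ id id)) ⊨denominator
    where
    ⊨X = λ {χ} → ⊨Γ {χ} ∘ Equivalence.from Γ∼

  sound-any (t ∷ _)  (c , _)  (here D∼)   ⊨D = sound t c (⊨D ∘ Equivalence.from D∼)
  sound-any (_ ∷ ts) (_ , cs) (there D∼∈) ⊨D = sound-any ts cs D∼∈ ⊨D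

  -- Decidability of admissibility

  body : ℒ → Maybe ℒ₀
  body (△ _ _ α) = just α
  body _         = nothing

  -- All non-zero grades demanded by X sit on these formulas; duplicates are removed because a sum
  -- must count each of them once.
  bodies : FinSet → List ℒ₀
  bodies X = deduplicate _≟_ (mapMaybe body X)

  bodies-! : ∀ X → Unique (bodies X)
  bodies-! X = DecUnique.deduplicate-! _≟_ (mapMaybe body X)

  ∈-bodies⁺ : ∀ {X i k α} → △ i k α ∈ X → α ∈ bodies X
  ∈-bodies⁺ △∈X = ∈-deduplicate⁺ _≟_ (∈-mapMaybe⁺ body △∈X refl)

  ∈-bodies⁻ : ∀ X {α} → α ∈ bodies X → ∃[ i ] ∃[ k ] △ i k α ∈ X
  ∈-bodies⁻ X α∈ with ∈-mapMaybe⁻ body X (∈-deduplicate⁻ _≟_ (mapMaybe body X) α∈)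
  ... | △ i k α , △∈X , refl = i , k , △∈X

  maxGrade≢0 : ∀ X i {α} → maxGrade X i α ≢ fin 0 → α ∈ bodies X
  maxGrade≢0 X i {α} ≢0 with maxGrade-attained X i α
  ... | inj₁ ≡0           = contradiction ≡0 ≢0
  ... | inj₂ (_ , _ , △∈) = ∈-bodies⁺ △∈

  droppedGrade≢0 : ∀ X Y i {α} → droppedGrade X Y i α ≢ fin 0 → α ∈ bodies X
  droppedGrade≢0 X Y i {α} ≢0 with maxGrade-attained (dropped X Y) i α
  ... | inj₁ ≡0           = contradiction ≡0 ≢0
  ... | inj₂ (_ , _ , △∈) = ∈-bodies⁺ (proj₁ (∈-dropped⁻ X Y △∈))

  -- `Max⁰` determines its value, so the function in the admissibility condition agrees with
  -- `droppedGrade`. With the converse below, a condition on a possibly infinite sum becomes a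
  -- decidable one on a finite sum.
  agentAdmissible⇒≤ : ∀ {J X Y δ i} → AgentAdmissible J X Y δ → i ∈ₛ value J →
                      ∑ (bodies X) (droppedGrade X Y i) ≤⁺ fin (δ i)
  agentAdmissible⇒≤ {X = X} {Y} {δ} {i} adm i∈J with f , f-max , sum ← adm i i∈J =
    subst (_≤⁺ fin (δ i))
      (∑-cong (bodies X) λ {α} _ → Max⁰-unique (f-max α) (droppedGrade-max X Y i α))
      (∑≤SumAtMost sum (bodies-! X) λ _ → tt)

  ≤⇒agentAdmissible : ∀ {J X Y δ} →
    (∀ i → i ∈ₛ value J → ∑ (bodies X) (droppedGrade X Y i) ≤⁺ fin (δ i)) →
    AgentAdmissible J X Y δ
  ≤⇒agentAdmissible {X = X} {Y} ∑≤δ i i∈J = droppedGrade X Y i , droppedGrade-max X Y i ,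
    mkSumAtMost (bodies-! X) (λ _ → tt) (λ _ → droppedGrade≢0 X Y i) (∑≤δ i i∈J)

  agentAdmissible? : ∀ J X Y δ → Dec (AgentAdmissible J X Y δ)
  agentAdmissible? J X Y δ = map′
    (≤⇒agentAdmissible {J} {X} {Y} {δ})
    (λ adm i → agentAdmissible⇒≤ {J} {X} {Y} {δ} adm)
    (all? λ i → i ∈ₛ? value J →-dec ∑ (bodies X) (droppedGrade X Y i) ≤ω? fin (δ i))

  boxesAdmissible? : ∀ J X Y δ → Dec (BoxesAdmissible J X Y δ)
  boxesAdmissible? J X Y δ =
    map′ (λ all J′ k′ ψ □∈X → All.lookup all □∈X) (λ adm → All.tabulate (tabulate adm))
         (All.all? admissible? X)
    where
    BoxAdmissible : ℒ → Set
    BoxAdmissible (□ J′ k′ ψ) = □ J′ k′ ψ ∈ Y ⇔ (value J′ ⊆ₛ value J × sumOver J′ δ ≤ k′)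
    BoxAdmissible _           = ⊤

    admissible? : Decidable BoxAdmissible
    admissible? (□ J′ k′ ψ) =
      (□ J′ k′ ψ ∈? Y) ⇔-dec (value J′ ⊆ₛ? value J ×-dec sumOver J′ δ ℕ.≤? k′)
    admissible? (atom _)    = yes tt
    admissible? (¬' _)      = yes tt
    admissible? (_ ∧' _)    = yes tt
    admissible? (△ _ _ _)   = yes tt

    tabulate : BoxesAdmissible J X Y δ → ∀ {χ} → χ ∈ X → BoxAdmissible χ
    tabulate adm {□ J′ k′ ψ} □∈X = adm J′ k′ ψ □∈X
    tabulate adm {atom _}    _   = tt
    tabulate adm {¬' _}      _   = tt
    tabulate adm {_ ∧' _}    _   = tt
    tabulate adm {△ _ _ _}   _   = tt

  admissibleAt? : ∀ J k X Y δ → Dec (AdmissibleAt J k X Y δ)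
  admissibleAt? J k X Y δ =
    (sumOver J δ ℕ.≟ k) ×-dec boxesAdmissible? J X Y δ ×-dec agentAdmissible? J X Y δ

  sumOver-cong : ∀ J {δ δ′} → (∀ {i} → i ∈ₛ value J → δ i ≡ δ′ i) → sumOver J δ ≡ sumOver J δ′
  sumOver-cong J δ≗δ′ = sum-cong (members J) (δ≗δ′ ∘ ∈-members⁻ J)

  admissibleAt-cong : ∀ {J k X Y δ δ′} → (∀ {i} → i ∈ₛ value J → δ i ≡ δ′ i) →
                      AdmissibleAt J k X Y δ → AdmissibleAt J k X Y δ′
  admissibleAt-cong {J} {δ = δ} {δ′} δ≗δ′ (sum≡k , boxes , agents) =
    trans (sym (sumOver-cong J δ≗δ′)) sum≡k ,
    (λ J′ k′ ψ □∈X → let iff = boxes J′ k′ ψ □∈X in mk⇔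
      (λ □∈Y → let J′⊆J , sum≤k′ = Equivalence.to iff □∈Y in
        (λ {i} → J′⊆J {i}) , subst (_≤ k′) (sumOver-cong J′ (δ≗δ′ ∘ J′⊆J)) sum≤k′)
      (λ (J′⊆J , sum≤k′) → Equivalence.from iff
        ((λ {i} → J′⊆J {i}) , subst (_≤ k′) (sym (sumOver-cong J′ (δ≗δ′ ∘ J′⊆J))) sum≤k′))) ,
    λ i i∈J → let f , f-max , sum = agents i i∈J in
      f , f-max , subst (SumAtMost (λ _ → ⊤) f) (δ≗δ′ i∈J) sum

  -- The values of δ outside J are irrelevant, so δ may be assumed to vanish
  -- there, and then all its values are at most k.
  admissible? : ∀ J k X → Decidable (Admissible J k X)
  admissible? J k X Y = map′ (λ (δ , _ , adm) → δ , adm) bound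
    (bounded-∃? k (λ δ≗δ′ → admissibleAt-cong {J} {k} {X} {Y} λ {i} _ → δ≗δ′ i) (admissibleAt? J k X Y))
    where
    bound : Admissible J k X Y → ∃[ δ ] (∀ i → δ i ≤ k) × AdmissibleAt J k X Y δ
    bound (δ , adm@(sum≡k , _)) = restricted , restricted≤k ,
      admissibleAt-cong {J} {k} {X} {Y} agree adm
      where
      restricted : Agt → ℕ
      restricted i with i ∈ₛ? value J
      ... | yes _ = δ i
      ... | no  _ = 0
      restricted≤k : ∀ i → restricted i ≤ k
      restricted≤k i with i ∈ₛ? value J
      ... | yes i∈J = subst (δ i ≤_) sum≡k (term≤sum δ (∈-members⁺ J i∈J))
      ... | no  _   = z≤n
      agree : ∀ {i} → i ∈ₛ value J → δ i ≡ restricted i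
      agree {i} i∈J with i ∈ₛ? value J
      ... | yes _  = refl
      ... | no i∉J = contradiction i∈J i∉J

  admissible-resp : ∀ {J k X Y Y′} → Y ⊆ Y′ → Y′ ⊆ Y → Admissible J k X Y → Admissible J k X Y′
  admissible-resp {X = X} {Y} {Y′} Y⊆Y′ Y′⊆Y (δ , sum≡k , boxes , agents) = δ , sum≡k ,
    (λ J′ k′ ψ □∈X → let iff = boxes J′ k′ ψ □∈X in
      mk⇔ (Equivalence.to iff ∘ Y′⊆Y) (Y⊆Y′ ∘ Equivalence.from iff)) ,
    λ i i∈J → let f , f-max , sum = agents i i∈J in
      f , (λ α → Max⁰-cong (transport {i} {α} Y′⊆Y) (transport {i} {α} Y⊆Y′) (f-max α)) , sum
    where
    transport : ∀ {i α g Z Z′} → Z′ ⊆ Z → DroppedGrade X Z i α g → DroppedGrade X Z′ i α g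
    transport Z′⊆Z (k , ≡g , △∈X , △∉Z) = k , ≡g , △∈X , △∉Z ∘ Z′⊆Z

  denominator-⊆ : ∀ {J φ Y Y′} → Y ⊆ Y′ → denominator J φ Y ⊆ denominator J φ Y′
  denominator-⊆ Y⊆Y′ (here refl) = here refl
  denominator-⊆ {J} {Y = Y} Y⊆Y′ (there χ∈)
    with _ , ψ∈Y , eq ← ∈-mapMaybe⁻ (unbox J) Y χ∈ = there (∈-mapMaybe⁺ (unbox J) (Y⊆Y′ ψ∈Y) eq)

  -- Size and atom bounds

  size : ∀ {l} → Formula l → ℕ
  size (atom _)  = 1
  size (¬' φ)    = suc (size φ)
  size (φ ∧' ψ)  = suc (size φ + size ψ)
  size (△ _ _ α) = suc (size α)
  size (□ _ _ φ) = suc (size φ)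

  -- The bound is strict, so the atom with index N is already fresh for a formula bounded by N.
  atomBound : ∀ {l} → Formula l → ℕ
  atomBound (atom p)  = suc (atomIndex p)
  atomBound (¬' φ)    = atomBound φ
  atomBound (φ ∧' ψ)  = atomBound φ ⊔ atomBound ψ
  atomBound (△ _ _ α) = atomBound α
  atomBound (□ _ _ φ) = atomBound φ

  size-↑ : ∀ α → size (↑ α) ≡ size α
  size-↑ (atom _)  = refl
  size-↑ (¬' α)    = cong suc (size-↑ α)
  size-↑ (α ∧' β)  = cong₂ (λ a b → suc (a + b)) (size-↑ α) (size-↑ β)
  size-↑ (△ _ _ α) = refl

  atomBound-↑ : ∀ α → atomBound (↑ α) ≡ atomBound α
  atomBound-↑ (atom _)  = refl
  atomBound-↑ (¬' α)    = atomBound-↑ α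
  atomBound-↑ (α ∧' β)  = cong₂ _⊔_ (atomBound-↑ α) (atomBound-↑ β)
  atomBound-↑ (△ _ _ α) = refl

  totalSize : FinSet → ℕ
  totalSize Γ = sum (map size Γ)

  Bounded : ℕ → FinSet → Set
  Bounded N Γ = ∀ {χ} → χ ∈ Γ → atomBound χ ≤ N

  -- The measure counts repetitions and is thus not invariant under set equality. The search handles
  -- permutations and passes to `∼[ set ]` only when it states a rule instance.
  totalSize-↭ : ∀ {Γ Δ} → Γ ↭ Δ → totalSize Γ ≡ totalSize Δ
  totalSize-↭ Γ↭Δ = sum-↭ (map⁺ size Γ↭Δ)

  unboxedSize : Group → ℒ → ℕ
  unboxedSize J χ = maybe size 0 (unbox J χ)

  unboxedSize≤ : ∀ J χ → unboxedSize J χ ≤ size χ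
  unboxedSize≤ J (atom _)  = z≤n
  unboxedSize≤ J (¬' _)    = z≤n
  unboxedSize≤ J (_ ∧' _)  = z≤n
  unboxedSize≤ J (□ _ _ ψ) = ℕ.n≤1+n (size ψ)
  unboxedSize≤ J (△ i _ α) with does (i ∈ₛ? value J)
  ... | true  = subst (_≤ suc (size α)) (sym (size-↑ α)) (ℕ.n≤1+n (size α))
  ... | false = z≤n

  totalSize-unboxed : ∀ J Y → totalSize (mapMaybe (unbox J) Y) ≡ sum (map (unboxedSize J) Y)
  totalSize-unboxed J []      = refl
  totalSize-unboxed J (χ ∷ Y) with unbox J χ
  ... | just ψ  = cong (size ψ +_) (totalSize-unboxed J Y)
  ... | nothing = totalSize-unboxed J Y

  -- The strict decrease comes from the box lost by the principal formula. Unboxing enlarges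
  -- nothing, and a ¬□ occurring in Y is discarded by `unbox`, so the principal formula is not
  -- counted twice.
  totalSize-denominator : ∀ {J k φ Γ Y} → ¬' □ J k φ ∈ Γ → Y ∈ subsequences Γ →
                          totalSize (denominator J φ Y) < totalSize Γ
  totalSize-denominator {J} {k} {φ} {Γ} {Y} ¬□∈Γ Y∈ with X , Γ↭ ← extract ¬□∈Γ = begin-strict
    size (¬' φ) + totalSize (mapMaybe (unbox J) Y)  ≡⟨ cong (size (¬' φ) +_) (totalSize-unboxed J Y) ⟩
    size (¬' φ) + sum (map (unboxedSize J) Y)       ≤⟨ ℕ.+-monoʳ-≤ (size (¬' φ))
                                                            (subsequences-sum (unboxedSize J) Γ Y∈) ⟩
    size (¬' φ) + sum (map (unboxedSize J) Γ)       ≡⟨ cong (size (¬' φ) +_)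
                                                            (sum-↭ (map⁺ (unboxedSize J) Γ↭)) ⟩
    size (¬' φ) + sum (map (unboxedSize J) X)       ≤⟨ ℕ.+-monoʳ-≤ (size (¬' φ))
                                                            (sum-mono X (unboxedSize≤ J)) ⟩
    size (¬' φ) + totalSize X                       <⟨ ℕ.n<1+n _ ⟩
    size (¬' □ J k φ) + totalSize X                 ≡⟨ sym (totalSize-↭ Γ↭) ⟩
    totalSize Γ                                     ∎
    where open ℕ.≤-Reasoning

  denominator-bounded : ∀ {N J k φ Γ Y} → Bounded N Γ → ¬' □ J k φ ∈ Γ → Y ⊆ Γ →
                        Bounded N (denominator J φ Y)
  denominator-bounded bounded ¬□∈Γ Y⊆Γ χ∈ with denominator-elim χ∈
  ... | inj₁ refl                                      = bounded ¬□∈Γ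
  ... | inj₂ (inj₁ (J′ , k′ , □∈Y))                    = bounded (Y⊆Γ □∈Y)
  ... | inj₂ (inj₂ (i , k′ , α , i∈J , △∈Y , refl)) =
    subst (_≤ _) (sym (atomBound-↑ α)) (bounded (Y⊆Γ △∈Y))

  -- X ⊢ χ: χ lies in the closure of X under the Boolean tableau rules read upwards.
  infix 4 _⊢_

  data _⊢_ (X : FinSet) : ℒ → Set where
    hyp  : ∀ {χ} → χ ∈ X → X ⊢ χ
    ¬¬-I : ∀ {φ} → X ⊢ φ → X ⊢ ¬' ¬' φ
    ∧-I  : ∀ {φ ψ} → X ⊢ φ → X ⊢ ψ → X ⊢ φ ∧' ψ
    ¬∧-I₁ : ∀ {φ ψ} → X ⊢ ¬' φ → X ⊢ ¬' (φ ∧' ψ)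
    ¬∧-I₂ : ∀ {φ ψ} → X ⊢ ¬' ψ → X ⊢ ¬' (φ ∧' ψ)

  ⊢-sound : ∀ {S U X χ} → Satisfies S U X → X ⊢ χ → S , U ⊨ χ
  ⊢-sound ⊨X (hyp χ∈X)            = ⊨X χ∈X
  ⊢-sound {S} {U} ⊨X (¬¬-I ⊢φ)    = λ ⊭φ → ⊭φ (⊢-sound {S} {U} ⊨X ⊢φ)
  ⊢-sound {S} {U} ⊨X (∧-I ⊢φ ⊢ψ)  = ⊢-sound {S} {U} ⊨X ⊢φ , ⊢-sound {S} {U} ⊨X ⊢ψ
  ⊢-sound {S} {U} ⊨X (¬∧-I₁ ⊢¬φ)  = λ (⊨φ , _) → ⊢-sound {S} {U} ⊨X ⊢¬φ ⊨φ
  ⊢-sound {S} {U} ⊨X (¬∧-I₂ ⊢¬ψ)  = λ (_ , ⊨ψ) → ⊢-sound {S} {U} ⊨X ⊢¬ψ ⊨ψ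

  -- Literals, conflicts and diamonds

  data Literal : ℒ → Set where
    atom⁺ : ∀ {p} → Literal (atom p)
    atom⁻ : ∀ {p} → Literal (¬' atom p)
    △⁺    : ∀ {i k α} → Literal (△ i k α)
    △⁻    : ∀ {i k α} → Literal (¬' △ i k α)
    □⁺    : ∀ {J k φ} → Literal (□ J k φ)
    □⁻    : ∀ {J k φ} → Literal (¬' □ J k φ)

  -- A pair □ φ, ¬□ φ with the same J and k needs no clause: δ sums to k over J, so every label
  -- contains the box, and φ meets ¬φ in the denominator.
  Conflict : FinSet → ℒ → Set
  Conflict X (atom p)       = ¬' atom p ∈ X
  Conflict X (¬' △ i k α)   = value k ≤⁺ maxGrade X i α
  Conflict X _              = ⊥

  Diamond : Set
  Diamond = Group × ℕ × ℒ

  diamond : ℒ → Maybe Diamond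
  diamond (¬' □ J k φ) = just (J , k , φ)
  diamond _            = nothing

  diamonds : FinSet → List Diamond
  diamonds = mapMaybe diamond

  ∈-diamonds⁻ : ∀ X {J k φ} → (J , k , φ) ∈ diamonds X → ¬' □ J k φ ∈ X
  ∈-diamonds⁻ X d∈ with ∈-mapMaybe⁻ diamond X d∈
  ... | ¬' □ J k φ , ∈X , refl = ∈X

  diamond-group : ∀ X → Fin (length (diamonds X)) → Group
  diamond-group X j = proj₁ (lookup (diamonds X) j)

  -- The tagged tree model

  module Completeness (N : ℕ) where

    record Saturated (X : FinSet) : Set where
      field
        literal    : ∀ {χ} → χ ∈ X → Literal χ
        consistent : ∀ {χ} → χ ∈ X → ¬ Conflict X χ
        bounded    : Bounded N X

    -- The child's label is not the denominator but a set reached from it by Boolean rules;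
    -- `entails` leads back.
    record Edge (X : FinSet) (d : Diamond) (X′ : FinSet) : Set where
      field
        Y          : FinSet
        δ          : Agt → ℕ
        admissible : AdmissibleAt (proj₁ d) (proj₁ (proj₂ d)) X Y δ
        entails    : ∀ {χ} → χ ∈ denominator (proj₁ d) (proj₂ (proj₂ d)) Y → X′ ⊢ χ

    data Node (X : FinSet) : Set where
      node : Saturated X →
             (X′ : Fin (length (diamonds X)) → FinSet) →
             (∀ j → Edge X (lookup (diamonds X) j) (X′ j)) →
             (∀ j → Node (X′ j)) → Node X

    -- The atom is negated because only formulas false at the target count in a distance: so exactly
    -- one tag counts for each state of the tree.
    tag : ℕ → ℒ₀
    tag c = ¬' atom (atomAt (N + c))

    atomIndex-tag : ∀ c → atomIndex (atomAt (N + c)) ≡ N + c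
    atomIndex-tag c = Inverse.strictlyInverseˡ Atm↔ℕ (N + c)

    tag-injective : ∀ {c c′} → tag c ≡ tag c′ → c ≡ c′
    tag-injective {c} {c′} eq = ℕ.+-cancelˡ-≡ N c c′
      (trans (sym (atomIndex-tag c)) (trans (cong index eq) (atomIndex-tag c′)))
      where
      index : ℒ₀ → ℕ
      index (¬' atom p) = atomIndex p
      index _           = 0

    bounded⇒≢tag : ∀ {α c} → atomBound α ≤ N → α ≢ tag c
    bounded⇒≢tag {c = c} ≤N refl = ℕ.<⇒≱ (s≤s (ℕ.m≤m+n N c))
      (subst (λ m → suc m ≤ N) (atomIndex-tag c) ≤N)

    tag? : ∀ α → Dec (∃[ c ] α ≡ tag c)
    tag? α = map′ (λ eq → c , eq) (λ { (c′ , refl) → cong tag (sym (guess c′)) }) (α ≟ tag c)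
      where
      -- The only candidate, since `tag c` has the bound `suc (N + c)`.
      c = atomBound α ∸ suc N
      guess : ∀ c′ → atomBound (tag c′) ∸ suc N ≡ c′
      guess c′ = trans (cong (_∸ N) (atomIndex-tag c′)) (ℕ.m+n∸m≡n N c′)

    -- The state named c with label X.  For the agents outside its group, the tag of a
    -- successor gets the grade ω as well.
    module Canonical (X : FinSet) (c : ℕ) {m : ℕ} (group : Fin m → Group)
                     (δ : Fin m → Agt → ℕ) (succ : Fin m → State) where

      Valued : Atm → Set
      Valued p = atom p ∈ X ⊎ atomIndex p ≡ N + c

      valued? : Decidable Valued
      valued? p = (atom p ∈? X) ⊎-dec (atomIndex p ℕ.≟ N + c)

      falsified? : ∀ j → Decidable (Falsified (succ j))
      falsified? j α = ¬? (⊨₀-dec (succ j) α)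

      falsifiedBodies : Fin m → List ℒ₀
      falsifiedBodies j = filter (falsified? j) (bodies X)

      weight : Fin m → Agt → ℕω
      weight j i = ∑ (falsifiedBodies j) (maxGrade X i)

      childTagGrade : Fin m → Agt → ℕω
      childTagGrade j i with i ∈ₛ? value (group j)
      -- Neither `∸` nor `toℕω` loses information in the tree model: `weight≤δ` shows that the
      -- weight is finite and at most δ.
      ... | yes _ = fin (δ j i ∸ toℕω (weight j i))
      ... | no  _ = ω

      Child : ℕ → Set
      Child c′ = Σ (Fin m) λ j → childName (toℕ j) c ≡ c′

      child? : Decidable Child
      child? c′ = any? λ j → childName (toℕ j) c ℕ.≟ c′

      gradeIfChild : ∀ {c′} → Agt → Dec (Child c′) → ℕω
      gradeIfChild i (yes (j , _)) = childTagGrade j i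
      gradeIfChild i (no _)        = ω

      tagGrade : Agt → ℕ → ℕω
      tagGrade i c′ = gradeIfChild i (child? c′)

      -- Off the tags this is the least grade that makes the positive △-formulas of X true, so a
      -- negative one can fail only through a conflict.
      grades : Agt → ℒ₀ → ℕω
      grades i α with tag? α
      ... | yes (c′ , _) = tagGrade i c′
      ... | no  _        = maxGrade X i α

      state : State
      state = record { base = grades ; val = λ p → isYes (valued? p) }

      grades-tag : ∀ i c′ → grades i (tag c′) ≡ tagGrade i c′
      grades-tag i c′ with tag? (tag c′)
      ... | yes (c″ , eq) = cong (tagGrade i) (sym (tag-injective eq))
      ... | no  ¬tag      = contradiction (c′ , refl) ¬tag

      grades-untagged : ∀ i {α} → (∀ {c′} → α ≢ tag c′) → grades i α ≡ maxGrade X i α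
      grades-untagged i {α} ≢tag with tag? α
      ... | yes (_ , eq) = contradiction eq ≢tag
      ... | no  _        = refl

      tagGrade-child : ∀ i j → tagGrade i (childName (toℕ j) c) ≡ childTagGrade j i
      tagGrade-child i j = by (child? (childName (toℕ j) c))
        where
        by : (d : Dec (Child (childName (toℕ j) c))) → gradeIfChild i d ≡ childTagGrade j i
        by (no  ¬child)    = contradiction (j , refl) ¬child
        by (yes (j′ , eq)) = cong (λ j → childTagGrade j i)
          (toℕ-injective (proj₁ (childName-injective (toℕ j′) c (toℕ j) c eq)))

      childTagGrade-member : ∀ {i} j → i ∈ₛ value (group j) →
                             childTagGrade j i ≡ fin (δ j i ∸ toℕω (weight j i))
      childTagGrade-member {i} j i∈ with i ∈ₛ? value (group j)
      ... | yes _ = refl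
      ... | no i∉ = contradiction i∈ i∉

      tagGrade≢ω⇒child : ∀ {i c′} → tagGrade i c′ ≢ ω → Child c′
      tagGrade≢ω⇒child {i} {c′} = by (child? c′)
        where
        by : (d : Dec (Child c′)) → gradeIfChild i d ≢ ω → Child c′
        by (yes child) _  = child
        by (no  _)     ≢ω = contradiction refl ≢ω

      childTagGrade≢ω⇒member : ∀ {i j} → childTagGrade j i ≢ ω → i ∈ₛ value (group j)
      childTagGrade≢ω⇒member {i} {j} ≢ω with i ∈ₛ? value (group j)
      ... | yes i∈ = i∈
      ... | no  _  = contradiction refl ≢ω

      tag-falsified : Falsified state (tag c)
      tag-falsified ⊨tag = ⊨tag (fromWitness (inj₂ (atomIndex-tag c)))

      tag-falsified⁻ : Bounded N X → ∀ {c′} → Falsified state (tag c′) → c′ ≡ c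
      tag-falsified⁻ bounded {c′} ⊭tag
        with decidable-stable (valued? (atomAt (N + c′))) (λ ¬v → ⊭tag (¬v ∘ toWitness))
      ... | inj₁ ∈X = contradiction (subst (λ a → suc a ≤ N) (atomIndex-tag c′) (bounded ∈X))
                                    (ℕ.<⇒≱ (s≤s (ℕ.m≤m+n N c′)))
      ... | inj₂ eq = ℕ.+-cancelˡ-≡ N c′ c (trans (sym (atomIndex-tag c′)) eq)

    -- Names are handed down the tree, while states are built upwards: the slack in a tag's grade
    -- depends on which bodies are false at the successor.
    stateOf : ∀ {X} → ℕ → Node X → State
    stateOf {X} c (node _ _ edge child) = Canonical.state X c (diamond-group X)
      (λ j → Edge.δ (edge j)) (λ j → stateOf (childName (toℕ j) c) (child j))

    falsifies-tag : ∀ {X} c (t : Node X) → Falsified (stateOf c t) (tag c)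
    falsifies-tag {X} c (node _ _ edge child) = Canonical.tag-falsified X c (diamond-group X)
      (λ j → Edge.δ (edge j)) (λ j → stateOf (childName (toℕ j) c) (child j))

    falsifies-tag⁻ : ∀ {X} c (t : Node X) {c′} → Falsified (stateOf c t) (tag c′) → c′ ≡ c
    falsifies-tag⁻ {X} c (node sat _ edge child) = Canonical.tag-falsified⁻ X c (diamond-group X)
      (λ j → Edge.δ (edge j)) (λ j → stateOf (childName (toℕ j) c) (child j)) (Saturated.bounded sat)

    -- Truth in the tree model

    data Reach {X₀ : FinSet} (root : Node X₀) : ℕ → ∃ Node → Set where
      here : Reach root 0 (X₀ , root)
      step : ∀ {c X sat X′ edge child} → Reach root c (X , node sat X′ edge child) →
             ∀ j → Reach root (childName (toℕ j) c) (X′ j , child j)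

    -- A tag reveals only a name. This lemma turns the name of a successor back into the successor
    -- itself, by removing the last step of both paths.
    reach-unique : ∀ {X₀} {root : Node X₀} {c c′ t t′} → Reach root c t → Reach root c′ t′ →
                   c ≡ c′ → t ≡ t′
    reach-unique here         here           _  = refl
    reach-unique here         (step {c} r j) eq = contradiction (sym eq) (childName≢0 (toℕ j) c)
    reach-unique (step {c} r j) here         eq = contradiction eq (childName≢0 (toℕ j) c)
    reach-unique (step {c} r j) (step {c′} r′ j′) eq
      with j≡ , c≡ ← childName-injective (toℕ j) c (toℕ j′) c′ eq
      with refl ← reach-unique r r′ c≡
      with refl ← toℕ-injective j≡ = refl

    module Truth {X₀ : FinSet} (root : Node X₀) where

      U : Pred State 0ℓ
      U S = ∃[ c ] ∃[ t ] Reach root c t × S ≡ stateOf c (proj₂ t)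

      module AtNode {X : FinSet} {sat : Saturated X} {X′ : Fin (length (diamonds X)) → FinSet}
        {edge : ∀ j → Edge X (lookup (diamonds X) j) (X′ j)} {child : ∀ j → Node (X′ j)}
        (c : ℕ) (r : Reach root c (X , node {X} sat X′ edge child))
        (⊨child : ∀ j → Satisfies (stateOf (childName (toℕ j) c) (child j)) U (X′ j)) where

        open Saturated sat

        name : Fin (length (diamonds X)) → ℕ
        name j = childName (toℕ j) c

        group : Fin (length (diamonds X)) → Group
        group = diamond-group X

        δ : Fin (length (diamonds X)) → Agt → ℕ
        δ j = Edge.δ (edge j)

        succ : Fin (length (diamonds X)) → State
        succ j = stateOf (name j) (child j)

        open Canonical X c group δ succ

        ⊨denominator : ∀ j {χ} →
          χ ∈ denominator (group j) (proj₂ (proj₂ (lookup (diamonds X) j))) (Edge.Y (edge j)) →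
          succ j , U ⊨ χ
        ⊨denominator j χ∈ = ⊢-sound {succ j} {U} (⊨child j) (Edge.entails (edge j) χ∈)

        body-untagged : ∀ {α c′} → α ∈ bodies X → α ≢ tag c′
        body-untagged α∈ with i , k , △∈X ← ∈-bodies⁻ X α∈ = bounded⇒≢tag (bounded △∈X)

        -- A △-formula of i kept in the label has its body in the denominator, hence true at the
        -- successor. For a false body all demands of i were therefore dropped, and admissibility
        -- bounds the dropped grades.
        weight≤δ : ∀ {i} j → i ∈ₛ value (group j) → weight j i ≤⁺ fin (δ j i)
        weight≤δ {i} j i∈ = ≤ω-trans (∑-mono (falsifiedBodies j) grade≤dropped)
          (≤ω-trans (∑-support-≤ (droppedGrade X Y i) (Unique.filter⁺ (falsified? j) (bodies-! X))
                      (bodies X) λ α∈ _ → proj₁ (∈-filter⁻ (falsified? j) {xs = bodies X} α∈))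
                    (agentAdmissible⇒≤ {group j} {X} {Y} {δ j}
                      (proj₂ (proj₂ (Edge.admissible (edge j)))) i∈))
          where
          Y = Edge.Y (edge j)
          grade≤dropped : ∀ {α} → α ∈ falsifiedBodies j → maxGrade X i α ≤⁺ droppedGrade X Y i α
          grade≤dropped {α} α∈ = maxGrade≤ X i α λ △∈X → △∈⇒≤maxGrade (∈-dropped⁺ △∈X λ △∈Y →
            proj₂ (∈-filter⁻ (falsified? j) {xs = bodies X} α∈)
              (↑-elim (succ j) U α (⊨denominator j (△-denominator i∈ △∈Y))))

        differing : Fin (length (diamonds X)) → List ℒ₀
        differing j = tag (name j) ∷ falsifiedBodies j

        differing-! : ∀ j → Unique (differing j)
        differing-! j =
          All.tabulate (λ α∈ eq → body-untagged
            (proj₁ (∈-filter⁻ (falsified? j) {xs = bodies X} α∈)) (sym eq))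
          ∷ Unique.filter⁺ (falsified? j) (bodies-! X)

        differing-falsified : ∀ j {α} → α ∈ differing j → Falsified (succ j) α
        differing-falsified j (here refl) = falsifies-tag (name j) (child j)
        differing-falsified j (there α∈)  = proj₂ (∈-filter⁻ (falsified? j) {xs = bodies X} α∈)

        differing-support : ∀ {i j α} → Falsified (succ j) α → base state i α ≢ fin 0 →
                            α ∈ differing j
        differing-support {i} {j} {α} ⊭α ≢0 = support (tag? α)
          where
          support : Dec (∃[ c′ ] α ≡ tag c′) → α ∈ differing j
          support (yes (c′ , refl)) = here (cong tag (falsifies-tag⁻ (name j) (child j) ⊭α))
          support (no ¬tag) = there (∈-filter⁺ (falsified? j) (maxGrade≢0 X i
            λ ≡0 → ≢0 (trans (grades-untagged i λ {c′} eq → ¬tag (c′ , eq)) ≡0)) ⊭α)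

        -- Equality is essential: the upper bound lets a ¬□ reach its witness, and the lower bound
        -- keeps away the boxes that are not in the label.
        agent-distance : ∀ {i} j → i ∈ₛ value (group j) →
                         ∑ (differing j) (base state i) ≡ fin (δ j i)
        agent-distance {i} j i∈ = begin
          grades i (tag (name j)) +ω ∑ (falsifiedBodies j) (grades i)
            ≡⟨ cong₂ _+ω_
                 (trans (grades-tag i (name j)) (trans (tagGrade-child i j) (childTagGrade-member j i∈)))
                 (trans (∑-cong (falsifiedBodies j) λ α∈ → grades-untagged i
                          (body-untagged (proj₁ (∈-filter⁻ (falsified? j) {xs = bodies X} α∈))))
                        (sym weight≡)) ⟩
          fin (δ j i ∸ toℕω (weight j i)) +ω fin (toℕω (weight j i))
            ≡⟨ cong fin (ℕ.m∸n+n≡m (Sup.[≤]-injective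
                 (subst (_≤⁺ fin (δ j i)) (sym weight≡) (weight≤δ j i∈)))) ⟩
          fin (δ j i) ∎
          where
          open ≡-Reasoning
          weight≡ : fin (toℕω (weight j i)) ≡ weight j i
          weight≡ = fin-toℕω (≤fin⇒≢ω (weight≤δ j i∈))

        untagged-grade : ∀ i {k α} → △ i k α ∈ X ⊎ ¬' △ i k α ∈ X → base state i α ≡ maxGrade X i α
        untagged-grade i (inj₁ ∈X) = grades-untagged i (bounded⇒≢tag (bounded ∈X))
        untagged-grade i (inj₂ ∈X) = grades-untagged i (bounded⇒≢tag (bounded ∈X))

        -- The target falsifies its own tag, so the grade that each agent of J gives to this tag is
        -- part of the distance.
        tagGrade-finite : ∀ {J k c′ i} (t : ∃ Node) → R J k state (stateOf c′ (proj₂ t)) →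
                          i ∈ₛ value J → tagGrade i c′ ≢ ω
        tagGrade-finite {J} {k} {c′} {i} (_ , t) d i∈J = ≤fin⇒≢ω (subst (_≤⁺ fin k) (grades-tag i c′)
          (≤ω-trans (term≤∑ (λ i → grades i (tag c′)) (∈-members⁺ J i∈J))
                    (term≤SumAtMost d {tag c′} (falsifies-tag c′ t))))

        -- A state within finite J-distance is a successor whose group contains J.
        near : ∀ {J k c′ t} → Reach root c′ t → R J k state (stateOf c′ (proj₂ t)) →
               ∃[ j ] t ≡ (X′ j , child j) × c′ ≡ name j × value J ⊆ₛ value (group j)
        near {J} {k} {c′} {t} r′ d with i₀ , i₀∈J ← inhabitant J
          with j , eq ← tagGrade≢ω⇒child {i₀} {c′} (tagGrade-finite {J} {k} {c′} t d i₀∈J) =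
          j , reach-unique r′ (step r j) (sym eq) , sym eq ,
          λ {i} i∈J → childTagGrade≢ω⇒member λ ≡ω → tagGrade-finite {J} {k} {c′} t d i∈J
            (trans (cong (tagGrade i) (sym eq)) (trans (tagGrade-child i j) ≡ω))

        truth : Satisfies state U X
        truth χ∈X with literal χ∈X
        ... | atom⁺ = fromWitness (inj₁ χ∈X)
        ... | △⁺ {i} {k} = subst (value k ≤⁺_) (sym (untagged-grade i (inj₁ χ∈X))) (△∈⇒≤maxGrade χ∈X)
        ... | △⁻ {i} {k} = λ k≤ → consistent χ∈X (subst (value k ≤⁺_) (untagged-grade i (inj₂ χ∈X)) k≤)
        ... | atom⁻ {p} = λ ⊨p → absurd (toWitness ⊨p)
          where
          absurd : ¬ Valued p
          absurd (inj₁ p∈X) = consistent p∈X χ∈X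
          absurd (inj₂ eq)  = ℕ.<⇒≱ (s≤s (ℕ.m≤m+n N c)) (subst (λ a → suc a ≤ N) eq (bounded χ∈X))
        ... | □⁻ {J} {k} {φ} = λ ⊨□ → refute (Any.index d∈) (Any.lookup-index d∈) ⊨□
          where
          d∈ : (J , k , φ) ∈ diamonds X
          d∈ = ∈-mapMaybe⁺ diamond χ∈X refl
          refute : ∀ j → (J , k , φ) ≡ lookup (diamonds X) j → ¬ (state , U ⊨ □ J k φ)
          refute j eq ⊨□ = subst (λ d → ¬ (state , U ⊨ □ (proj₁ d) (proj₁ (proj₂ d)) (proj₂ (proj₂ d))))
            (sym eq)
            -- The successor lies at distance k, because δ sums to k over its group, and its
            -- denominator begins with the negated formula.
            (λ ⊨□ → ⊨denominator j (here refl) (⊨□ (succ j) (name j , _ , step r j , refl)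
               (mkR {group j} {S = state} {succ j} (δ j) (differing-! j) (differing-falsified j)
                  (λ {i} _ → differing-support {i})
                  (λ i∈ → subst (_≤⁺ fin (δ j _)) (sym (agent-distance j i∈)) ≤ω-refl)
                  (ℕ.≤-reflexive (proj₁ (Edge.admissible (edge j)))))))
            ⊨□
        ... | □⁺ {J} {k} {ψ} = λ { S′ (c′ , t , r′ , refl) d → reached r′ d (near {J} {k} r′ d) }
          where
          reached : ∀ {c′ t} → Reach root c′ t → R J k state (stateOf c′ (proj₂ t)) →
                    ∃[ j ] t ≡ (X′ j , child j) × c′ ≡ name j × value J ⊆ₛ value (group j) →
                    stateOf c′ (proj₂ t) , U ⊨ ψ
          -- The distance for J is the sum of δ over J. It is at most k, so the right-to-left half
          -- of the box condition puts the box into the label.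
          reached _ d (j , refl , refl , J⊆) = ⊨denominator j (□-denominator
            (Equivalence.from (proj₁ (proj₂ (Edge.admissible (edge j))) J k ψ χ∈X)
              ((λ {i} → J⊆ {i}) , sum≤k)))
            where
            sum≤k : sumOver J (δ j) ≤ k
            sum≤k = Sup.[≤]-injective (subst (_≤⁺ fin k)
              (trans (∑-cong (members J) (λ i∈ → agent-distance j (J⊆ (∈-members⁻ J i∈))))
                     (∑-fin (members J) (δ j)))
              (distance≤ {J} {k} {state} {succ j} d (differing-! j) (differing-falsified j)))

      truth : ∀ {X c} (t : Node X) → Reach root c (X , t) → Satisfies (stateOf c t) U X
      truth {X} {c} (node sat X′ edge child) r =
        AtNode.truth c r λ j → truth (child j) (step r j)

    -- The decision procedure

    Closable : FinSet → Set
    Closable Γ = ∃ λ (t : Tableau Γ) → Closed t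

    Open : FinSet → Set
    Open Γ = ∃[ X ] Node X × (∀ {χ} → χ ∈ Γ → X ⊢ χ)

    closable-node : ∀ {Γ Ds} → Γ ⟶ Ds → All Closable Ds → Closable Γ
    closable-node rule cs = node rule (proj₁ (collect cs)) , proj₂ (collect cs)
      where
      collect : ∀ {Ds} → All Closable Ds → Σ (All Tableau Ds) AllClosed
      collect []             = [] , tt
      collect ((t , c) ∷ cs) with ts , cs′ ← collect cs = t ∷ ts , c , cs′

    closable-⊥ : Closable (⊥' ∷ [])
    closable-⊥ = leaf _ , here refl

    conflict⇒closable : ∀ {Γ χ} → χ ∈ Γ → Conflict Γ χ → Closable Γ
    conflict⇒closable {Γ} {atom p} p∈Γ ¬p∈Γ = closable-node
      (⊥-rule (absorb₂ p∈Γ ¬p∈Γ)) (closable-⊥ ∷ [])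
    conflict⇒closable {Γ} {¬' △ i k@(_ , Irrelevant.[ k≢0 ]) α} ¬△∈Γ k≤
      with maxGrade-attained Γ i α
    -- Here 0 is the default of the maximum and not the grade of a △-formula in Γ; grades in
    -- formulas are positive.
    ... | inj₁ ≡0 = ⊥-elim-irr (k≢0 (≤0⇒≡0 (subst (value k ≤⁺_) ≡0 k≤)))
    ... | inj₂ (k⁺ , ≡max , △∈Γ) with t , k⁺≡ ← ≤⇒∃+ω (subst (value k ≤⁺_) (sym ≡max) k≤) =
      closable-node (△-mon k k⁺ t k⁺≡ (absorb₂ △∈Γ ¬△∈Γ)) (closable-⊥ ∷ [])

    conflict? : ∀ X → Decidable (Conflict X)
    conflict? X (atom p)       = ¬' atom p ∈? X
    conflict? X (¬' △ i k α)   = value k ≤ω? maxGrade X i α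
    conflict? X (¬' atom _)    = no λ ()
    conflict? X (¬' ¬' _)      = no λ ()
    conflict? X (¬' (_ ∧' _))  = no λ ()
    conflict? X (¬' □ _ _ _)   = no λ ()
    conflict? X (_ ∧' _)       = no λ ()
    conflict? X (△ _ _ _)      = no λ ()
    conflict? X (□ _ _ _)      = no λ ()

    data Compound : ℒ → Set where
      ¬¬-compound : ∀ {φ} → Compound (¬' ¬' φ)
      ∧-compound  : ∀ {φ ψ} → Compound (φ ∧' ψ)
      ¬∧-compound : ∀ {φ ψ} → Compound (¬' (φ ∧' ψ))

    literal-or-compound : ∀ χ → Literal χ ⊎ Compound χ
    literal-or-compound (atom _)      = inj₁ atom⁺
    literal-or-compound (¬' atom _)   = inj₁ atom⁻
    literal-or-compound (¬' ¬' _)     = inj₂ ¬¬-compound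
    literal-or-compound (¬' (_ ∧' _)) = inj₂ ¬∧-compound
    literal-or-compound (¬' △ _ _ _)  = inj₁ △⁻
    literal-or-compound (¬' □ _ _ _)  = inj₁ □⁻
    literal-or-compound (_ ∧' _)      = inj₂ ∧-compound
    literal-or-compound (△ _ _ _)     = inj₁ △⁺
    literal-or-compound (□ _ _ _)     = inj₁ □⁺

    Decided : FinSet → Set
    Decided Γ = Closable Γ ⊎ Open Γ

    module □-Step {Γ : FinSet} (bounded : Bounded N Γ)
                  (decide : ∀ Δ → totalSize Δ < totalSize Γ → Bounded N Δ → Decided Δ)
                  {J : Group} {k : ℕ} {φ : ℒ} (¬□∈Γ : ¬' □ J k φ ∈ Γ) where

      labels : List FinSet
      labels = filter (admissible? J k Γ) (subsequences Γ)

      denominators : List FinSet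
      denominators = map (denominator J φ) labels

      label-subsequence : ∀ {Y} → Y ∈ labels → Y ∈ subsequences Γ
      label-subsequence = proj₁ ∘ ∈-filter⁻ (admissible? J k Γ) {xs = subsequences Γ}

      label-⊆ : ∀ {Y} → Y ∈ labels → Y ⊆ Γ
      label-⊆ = subsequences-⊆ Γ ∘ label-subsequence

      label-admissible : ∀ {Y} → Y ∈ labels → Admissible J k Γ Y
      label-admissible = proj₂ ∘ ∈-filter⁻ (admissible? J k Γ) {xs = subsequences Γ}

      complete : ∀ D → Any (D ∼[ set ]_) denominators ⇔
                 (∃[ Y ] Y ⊆ Γ × Admissible J k Γ Y × D ∼[ set ] denominator J φ Y)
      complete D = mk⇔ to from
        where
        to : Any (D ∼[ set ]_) denominators →
             ∃[ Y ] Y ⊆ Γ × Admissible J k Γ Y × D ∼[ set ] denominator J φ Y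
        to D∼∈ =
          let _ , E∈ , D∼E = find D∼∈
              Y , Y∈ , eq  = ∈-map⁻ (denominator J φ) E∈
          in Y , label-⊆ Y∈ , label-admissible Y∈ , subst (D ∼[ set ]_) eq D∼E
        from : (∃[ Y ] Y ⊆ Γ × Admissible J k Γ Y × D ∼[ set ] denominator J φ Y) →
               Any (D ∼[ set ]_) denominators
        from (Y , Y⊆Γ , adm , D∼) = lose (∈-map⁺ (denominator J φ) Y′∈)
          (mk⇔ (denominator-⊆ {J} {φ} Y⊆Y′ ∘ Equivalence.to D∼)
               (Equivalence.from D∼ ∘ denominator-⊆ {J} {φ} Y′⊆Y))
          where
          -- Y is an arbitrary list and may repeat entries; its trace on Γ has the same elements and
          -- is a subsequence.
          Y′ = filter (_∈? Y) Γ
          Y⊆Y′ : Y ⊆ Y′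
          Y⊆Y′ χ∈Y = ∈-filter⁺ (_∈? Y) (Y⊆Γ χ∈Y) χ∈Y
          Y′⊆Y : Y′ ⊆ Y
          Y′⊆Y χ∈ = proj₂ (∈-filter⁻ (_∈? Y) {xs = Γ} χ∈)
          Y′∈ : Y′ ∈ labels
          Y′∈ = ∈-filter⁺ (admissible? J k Γ) (filter∈subsequences (_∈? Y) Γ)
                  (admissible-resp {J} {k} {Γ} Y⊆Y′ Y′⊆Y adm)

      closable : All (Closable ∘ denominator J φ) labels → Closable Γ
      closable cs = closable-node (□-elim denominators (absorb ¬□∈Γ) complete) (All.map⁺ cs)

      edge : Any (Open ∘ denominator J φ) labels → ∃[ X′ ] Edge Γ (J , k , φ) X′ × Node X′
      edge open∈ =
        let Y , Y∈ , X′ , t , ⊢D = find open∈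
            δ , adm              = label-admissible Y∈
        in X′ , record { Y = Y ; δ = δ ; admissible = adm ; entails = ⊢D } , t

      decided : Closable Γ ⊎ (∃[ X′ ] Edge Γ (J , k , φ) X′ × Node X′)
      decided = Sum.map closable edge (all-or-any (All.tabulate λ {Y} Y∈ →
        decide (denominator J φ Y)
          (totalSize-denominator {J} {k} {φ} ¬□∈Γ (label-subsequence Y∈))
          (denominator-bounded {J = J} {k} {φ} bounded ¬□∈Γ (label-⊆ Y∈))))

    module _ {Γ : FinSet} {χ : ℒ} {X : FinSet} (Γ↭ : Γ ↭ χ ∷ X) where

      smaller : ∀ {m} → m < size χ + totalSize X → m < totalSize Γ
      smaller = subst (_ <_) (sym (totalSize-↭ Γ↭))

      head-bounded : Bounded N Γ → atomBound χ ≤ N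
      head-bounded bounded = bounded (∈-resp-↭ (↭-sym Γ↭) (here refl))

      tail-bounded : Bounded N Γ → Bounded N X
      tail-bounded bounded χ∈X = bounded (∈-resp-↭ (↭-sym Γ↭) (there χ∈X))

      open-premise : ∀ {Δ} → (∀ {Y} → (∀ {ψ} → ψ ∈ Δ → Y ⊢ ψ) → Y ⊢ χ) → X ⊆ Δ →
                     Open Δ → Open Γ
      open-premise intro X⊆Δ (Y , t , ⊢Δ) = Y , t , λ χ∈Γ → [ (λ { refl → intro ⊢Δ }) , ⊢Δ ∘ X⊆Δ ]′
        (Any.toSum (∈-resp-↭ Γ↭ χ∈Γ))

    ∷-bounded : ∀ {φ X} → atomBound φ ≤ N → Bounded N X → Bounded N (φ ∷ X)
    ∷-bounded φ≤N bounded (here refl) = φ≤N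
    ∷-bounded φ≤N bounded (there χ∈X) = bounded χ∈X

    open-saturated : ∀ {Γ} → Saturated Γ →
                     All (λ (d : Diamond) → ∃[ X′ ] Edge Γ d X′ × Node X′) (diamonds Γ) → Open Γ
    open-saturated {Γ} saturated edges =
      Γ , node saturated (proj₁ ∘ edgeAt) (proj₁ ∘ proj₂ ∘ edgeAt) (proj₂ ∘ proj₂ ∘ edgeAt) , hyp
      where
      edgeAt : ∀ j → ∃[ X′ ] Edge Γ (lookup (diamonds Γ) j) X′ × Node X′
      edgeAt j = All.lookup edges (∈-lookup j)

    -- A single ¬□ whose denominators all close suffices to close Γ, whereas an open Γ needs an open
    -- denominator for every ¬□.
    decide-literals : ∀ {Γ} → Bounded N Γ →
                      (∀ Δ → totalSize Δ < totalSize Γ → Bounded N Δ → Decided Δ) →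
                      All Literal Γ → Decided Γ
    decide-literals {Γ} bounded decide literals with Any.any? (conflict? Γ) Γ
    ... | yes conflict with _ , χ∈Γ , c ← find conflict = inj₁ (conflict⇒closable χ∈Γ c)
    ... | no ¬conflict = Sum.swap (Sum.map (open-saturated saturated) (proj₂ ∘ Any.satisfied)
      (all-or-any (All.tabulate λ d∈ →
        Sum.swap (□-Step.decided bounded decide (∈-diamonds⁻ Γ d∈)))))
      where
      saturated : Saturated Γ
      saturated = record
        { literal    = All.lookup literals
        ; consistent = λ χ∈Γ c → ¬conflict (lose χ∈Γ c)
        ; bounded    = bounded
        }

    decide : ∀ Γ → Acc _<_ (totalSize Γ) → Bounded N Γ → Decided Γ
    decide Γ (acc rec) bounded with All.decide literal-or-compound Γ
    ... | inj₁ literals = decide-literals bounded (λ Δ Δ< → decide Δ (rec Δ<)) literals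
    decide Γ (acc rec) bounded | inj₂ compound with find compound
    ... | ¬' ¬' φ , χ∈Γ , ¬¬-compound with X , Γ↭ ← extract χ∈Γ
      with decide (φ ∷ X) (rec (smaller Γ↭ (ℕ.m≤n+m _ 1)))
             (∷-bounded (head-bounded Γ↭ bounded) (tail-bounded Γ↭ bounded))
    ...   | inj₁ c  = inj₁ (closable-node (¬¬-rule (↭⇒∼set Γ↭)) (c ∷ []))
    ...   | inj₂ op = inj₂ (open-premise Γ↭ (λ ⊢Δ → ¬¬-I (⊢Δ (here refl))) there op)
    decide Γ (acc rec) bounded | inj₂ _ | φ ∧' ψ , χ∈Γ , ∧-compound with X , Γ↭ ← extract χ∈Γ
      with decide (φ ∷ ψ ∷ X)
             (rec (smaller Γ↭ (s≤s (ℕ.≤-reflexive (sym (ℕ.+-assoc (size φ) (size ψ) (totalSize X)))))))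
             (∷-bounded (ℕ.m⊔n≤o⇒m≤o (atomBound φ) (atomBound ψ) (head-bounded Γ↭ bounded))
               (∷-bounded (ℕ.m⊔n≤o⇒n≤o (atomBound φ) (atomBound ψ) (head-bounded Γ↭ bounded))
                 (tail-bounded Γ↭ bounded)))
    ...   | inj₁ c  = inj₁ (closable-node (∧-rule (↭⇒∼set Γ↭)) (c ∷ []))
    ...   | inj₂ op = inj₂ (open-premise Γ↭
              (λ ⊢Δ → ∧-I (⊢Δ (here refl)) (⊢Δ (there (here refl)))) (there ∘ there) op)
    decide Γ (acc rec) bounded | inj₂ _ | ¬' (φ ∧' ψ) , χ∈Γ , ¬∧-compound with X , Γ↭ ← extract χ∈Γ
      with decide (¬' φ ∷ X)
             (rec (smaller Γ↭ (s≤s (s≤s (ℕ.+-monoˡ-≤ (totalSize X) (ℕ.m≤m+n (size φ) (size ψ)))))))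
             (∷-bounded (ℕ.m⊔n≤o⇒m≤o (atomBound φ) (atomBound ψ) (head-bounded Γ↭ bounded))
               (tail-bounded Γ↭ bounded))
         | decide (¬' ψ ∷ X)
             (rec (smaller Γ↭ (s≤s (s≤s (ℕ.+-monoˡ-≤ (totalSize X) (ℕ.m≤n+m (size ψ) (size φ)))))))
             (∷-bounded (ℕ.m⊔n≤o⇒n≤o (atomBound φ) (atomBound ψ) (head-bounded Γ↭ bounded))
               (tail-bounded Γ↭ bounded))
    ...   | inj₁ c  | inj₁ d = inj₁ (closable-node (¬∧-rule (↭⇒∼set Γ↭)) (c ∷ d ∷ []))
    ...   | inj₂ op | _       = inj₂ (open-premise Γ↭ (λ ⊢Δ → ¬∧-I₁ (⊢Δ (here refl))) there op)
    ...   | inj₁ _  | inj₂ op = inj₂ (open-premise Γ↭ (λ ⊢Δ → ¬∧-I₂ (⊢Δ (here refl))) there op)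

    open⇒satisfiable : ∀ {φ} → Open (φ ∷ []) → Satisfiable φ
    open⇒satisfiable (X , t , ⊢φ) =
      stateOf 0 t , U , ⊢-sound {stateOf 0 t} {U} (truth t here) (⊢φ (here refl))
      where open Truth t

  -- The two directions

  completeness : ∀ φ → ¬ Satisfiable φ → ∃ λ (t : Tableau (φ ∷ [])) → Closed t
  completeness φ unsat
    -- N is the bound of the input formula. The rules bring in no larger atoms, so the tags stay
    -- fresh for every set in the search.
    with decide (φ ∷ []) (<-wellFounded _) (λ { (here refl) → ℕ.≤-refl })
    where open Completeness (atomBound φ)
  ... | inj₁ closable = closable
  ... | inj₂ op       = contradiction (Completeness.open⇒satisfiable (atomBound φ) op) unsat

  soundness : ∀ φ → ∃ (λ (t : Tableau (φ ∷ [])) → Closed t) → ¬ Satisfiable φ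
  soundness φ (t , closed) (S , U , ⊨φ) = sound t closed {S} {U} λ { (here refl) → ⊨φ }

theorem2 : (Atm : Set) (Atm↔ℕ : Atm ↔ ℕ) (n : ℕ) →
    let open LGDDA Atm Atm↔ℕ n in
    (φ : ℒ) → ∃ (λ (t : Tableau (φ ∷ [])) → Closed t) ⇔ (¬ Satisfiable φ)
theorem2 Atm Atm↔ℕ n φ = mk⇔ (soundness φ) (completeness φ)
  where open Tableaux Atm Atm↔ℕ n
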